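{- Let $A_3=\frac1z\frac{d}{dz}$. For $k=1,2,3,\dots$ the following representation is valid: $$A_3^{k}=\sum_{s=0}^{k}(-1)^{k-s}(2k-2s-1)!!\binom{2k-s-1}{s-1}\frac{1}{z^{2k-s}}\Big(\frac{d}{dz}\Big)^{s}.$$
   Context: Conventions: $(-1)!!=1$, and $\binom{p}{ -1}=0$ (so that the term $s=0$ vanishes). $A_3^{k}$ is the $k$-fold composition; operators act on entire and meromorphic functions on $\mathbb{C}$. -}

module Defs where

open import Algebra.Apartness.Bundles using (HeytingField)
open import Algebra.Bundles.Raw using (RawMonoid; RawRing)
import Algebra.Definitions.RawMonoid as RawMonoidDefinitions
import Algebra.Definitions.RawSemiring as RawSemiringDefinitions
open import Data.Fin.Base using (toℕ)
open import Data.Integer.Base as ℤ using (ℤ; +_; -[1+_]; -1ℤ; 1ℤ)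
open import Data.Nat.Base as ℕ using (ℕ; zero; suc; _∸_)
open import Data.Nat.Combinatorics using (_C_)
open import Data.Product.Base using (Σ; Σ-syntax; ∃-syntax; _×_; _,_; proj₁; proj₂)
open import Data.Sum.Base using (_⊎_; inj₁; inj₂)
open import Data.Unit.Base using (⊤)
import Function.Endo.Propositional as Endo
open import Function.Base using (_∘_)
open import Function.Bundles using (_⇔_; Equivalence)
open import Level using (0ℓ) renaming (suc to ℓsuc)
open import Relation.Binary.Core using (Rel)
open import Relation.Binary.Structures using (IsStrictPartialOrder)

-- Constructive axioms: classically x # y is just x ≉ y, and cotransitivity of <
-- follows from that of #.
record OrderedField : Set₁ where
  field
    heytingField : HeytingField 0ℓ 0ℓ 0ℓ

  open HeytingField heytingField public

  infix 4 _<_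

  field
    _<_                  : Rel Carrier 0ℓ
    isStrictPartialOrder : IsStrictPartialOrder _≈_ _<_
    #⇔<⊎>                : ∀ x y → x # y ⇔ (x < y ⊎ y < x)
    +-monoˡ-<            : ∀ x y z → x < y → x + z < y + z
    *-pos                : ∀ x y → 0# < x → 0# < y → 0# < x * y

  fromℕ : ℕ → Carrier
  fromℕ zero    = 0#
  fromℕ (suc n) = 1# + fromℕ n

  ∣_∣<_ : Rel Carrier 0ℓ
  ∣ x ∣< ε = (x < ε) × (- x < ε)

  Cauchy : (ℕ → Carrier) → Set
  Cauchy x = ∀ ε → 0# < ε →
    ∃[ N ] (∀ m n → N ℕ.≤ m → N ℕ.≤ n → ∣ x m - x n ∣< ε)

  _ConvergesTo_ : (ℕ → Carrier) → Carrier → Set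
  x ConvergesTo l = ∀ ε → 0# < ε →
    ∃[ N ] (∀ n → N ℕ.≤ n → ∣ x n - l ∣< ε)

-- The axioms characterise the real numbers up to isomorphism.
record Reals : Set₁ where
  field
    orderedField : OrderedField

  open OrderedField orderedField public

  field
    archimedean : ∀ x → ∃[ n ] (x < fromℕ n)
    complete    : ∀ x → Cauchy x → ∃[ l ] (x ConvergesTo l)


module ComplexNumbers (R : Reals) where

  private module ℝ = Reals R
  open ℝ using () renaming (Carrier to ℝ)

  record ℂ : Set where
    constructor _+i_
    field
      re : ℝ
      im : ℝ
  open ℂ public

  ℂ-rawRing : RawRing 0ℓ 0ℓ
  ℂ-rawRing = record
    { Carrier = ℂ
    ; _≈_     = λ z w → (re z ℝ.≈ re w) × (im z ℝ.≈ im w)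
    ; _+_     = λ z w → (re z ℝ.+ re w) +i (im z ℝ.+ im w)
    ; _*_     = λ z w → (re z ℝ.* re w ℝ.- im z ℝ.* im w)
                     +i (re z ℝ.* im w ℝ.+ im z ℝ.* re w)
    ; -_      = λ z → (ℝ.- re z) +i (ℝ.- im z)
    ; 0#      = ℝ.0# +i ℝ.0#
    ; 1#      = ℝ.1# +i ℝ.0#
    }

  open RawRing ℂ-rawRing public
    using (_≈_; _+_; _*_; -_; 0#; 1#; rawSemiring)
  open RawSemiringDefinitions rawSemiring public
    using (_^_) renaming (_×_ to _ℕ×_)

  infixl 6 _-_
  _-_ : ℂ → ℂ → ℂ
  z - w = z + (- w)

  fromℤ : ℤ → ℂ
  fromℤ (+ n)    = n ℕ× 1#
  fromℤ -[1+ n ] = - (suc n ℕ× 1#)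

  ∣_∣² : ℂ → ℝ
  ∣ z ∣² = re z ℝ.* re z ℝ.+ im z ℝ.* im z

  -- |z| < r, without square roots.  Only used for r > 0.
  ∣_∣<_ : ℂ → ℝ → Set
  ∣ z ∣< r = ∣ z ∣² ℝ.< r ℝ.* r

  NonZero : ℂ → Set
  NonZero z = ℝ.0# ℝ.< ∣ z ∣²

  -- conj z / |z|².  The library inverts differences, here |z|² - 0.
  inverse : ∀ z → NonZero z → ℂ
  inverse z z≠0 = (re z ℝ.* n⁻¹) +i (ℝ.- im z ℝ.* n⁻¹)
    where
    ∣z∣²#0 : ∣ z ∣² ℝ.# ℝ.0#
    ∣z∣²#0 = Equivalence.from (ℝ.#⇔<⊎> _ _) (inj₂ z≠0)
    n⁻¹ : ℝ
    n⁻¹ = proj₁ (ℝ.#⇒invertible ∣z∣²#0)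


module Operators (R : Reals) where

  open ComplexNumbers R public
  private module ℝ = Reals R
  open ℝ using () renaming (Carrier to ℝ)

  -- A value may a priori depend on the proof that the argument lies in the
  -- domain; Extensional excludes this.
  record PartialFn : Set₁ where
    field
      Dom : ℂ → Set
      val : ∀ z → Dom z → ℂ
  open PartialFn public

  record Extensional (f : PartialFn) : Set where
    field
      Dom-resp : ∀ {z w} → z ≈ w → Dom f z → Dom f w
      val-cong : ∀ {z w} (p : Dom f z) (q : Dom f w) → z ≈ w → val f z p ≈ val f w q

  -- Equality includes equality of the natural domains.
  infix 4 _≃_
  record _≃_ (f g : PartialFn) : Set where
    field
      Dom-⇔ : ∀ z → Dom f z ⇔ Dom g z
      val-≈ : ∀ z (p : Dom f z) (q : Dom g z) → val f z p ≈ val g z q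

  const : ℂ → PartialFn
  const c = record { Dom = λ _ → ⊤ ; val = λ _ _ → c }

  1/z^_ : ℕ → PartialFn
  1/z^ m = record { Dom = NonZero ; val = λ z z≠0 → inverse z z≠0 ^ m }

  _⊕_ : PartialFn → PartialFn → PartialFn
  f ⊕ g = record
    { Dom = λ z → Dom f z × Dom g z
    ; val = λ z (p , q) → val f z p + val g z q
    }

  _⊗_ : PartialFn → PartialFn → PartialFn
  f ⊗ g = record
    { Dom = λ z → Dom f z × Dom g z
    ; val = λ z (p , q) → val f z p * val g z q
    }

  -- w is the limit of (f z - f a) / (z - a) as z → a; in particular f is
  -- required to be defined on a neighbourhood of a.
  HasDerivative : PartialFn → ℂ → ℂ → Set
  HasDerivative f a w =
    Σ[ p ∈ Dom f a ] (∀ ε → ℝ.0# ℝ.< ε → ∃[ δ ] (ℝ.0# ℝ.< δ) ×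
      (∀ z → ∣ z - a ∣< δ → Dom f z ×
        (∀ (q : Dom f z) (z≠a : NonZero (z - a)) →
          ∣ (val f z q - val f a p) * inverse (z - a) z≠a - w ∣< ε)))

  Operator : Set₁
  Operator = PartialFn → PartialFn

  open Endo PartialFn public using () renaming (_^_ to _^∘_)

  -- D f is defined wherever f is complex differentiable.
  D : Operator
  D f = record
    { Dom = λ a → ∃[ w ] HasDerivative f a w
    ; val = λ a → proj₁
    }

  multiplyBy : PartialFn → Operator
  multiplyBy g f = g ⊗ f

  A₃ : Operator
  A₃ = multiplyBy (1/z^ 1) ∘ D

  HolomorphicOn : (ℂ → Set) → PartialFn → Set
  HolomorphicOn S f = ∀ a → S a → Dom (D f) a

  Disc : ℂ → ℝ → ℂ → Set
  Disc c r z = ∣ z - c ∣< r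

  -- f = g / h on the disc of radius r about c, with g and h holomorphic there
  -- and h not identically zero.
  record LocalQuotient (f : PartialFn) (c : ℂ) : Set₁ where
    field
      r             : ℝ
      r>0           : ℝ.0# ℝ.< r
      g h           : PartialFn
      g-extensional : Extensional g
      h-extensional : Extensional h
      g-holomorphic : HolomorphicOn (Disc c r) g
      h-holomorphic : HolomorphicOn (Disc c r) h
      h≢0           : ∃[ z ] Disc c r z × (Σ[ p ∈ Dom h z ] NonZero (val h z p))
      defined       : ∀ z → Disc c r z → (p : Dom h z) → NonZero (val h z p) → Dom f z
      quotient      : ∀ z → Disc c r z → (p : Dom f z) (q : Dom h z) (s : Dom g z) →
                      val f z p * val h z q ≈ val g z s

  -- Meromorphic functions on the whole plane, as local quotients of holomorphic
  -- functions.  Having a removable singularity outside Dom f is allowed, and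
  -- entire functions are the case where Dom f is everything.
  record Meromorphic (f : PartialFn) : Set₁ where
    field
      extensional   : Extensional f
      holomorphic   : HolomorphicOn (Dom f) f
      localQuotient : ∀ c → LocalQuotient f c

  infix 4 _≈ₒ_
  _≈ₒ_ : Rel Operator (ℓsuc 0ℓ)
  S ≈ₒ T = ∀ f → Meromorphic f → S f ≃ T f

  +ₒ-rawMonoid : RawMonoid (ℓsuc 0ℓ) (ℓsuc 0ℓ)
  +ₒ-rawMonoid = record
    { Carrier = Operator
    ; _≈_     = _≈ₒ_
    ; _∙_     = λ S T f → S f ⊕ T f
    ; ε       = λ _ → const 0#
    }

  -- T 0 + T 1 + ⋯ + T k
  ∑[0⋯_] : ℕ → (ℕ → Operator) → Operator
  ∑[0⋯ k ] T = RawMonoidDefinitions.sum +ₒ-rawMonoid {n = suc k} (T ∘ toℕ)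


-- The double factorial, with (-1)!! = 1.  Values below -1 are never used.
doubleFactorial : ℤ → ℕ
doubleFactorial (+ 0)                   = 1
doubleFactorial (+ 1)                   = 1
doubleFactorial (+ suc (suc n))     = suc (suc n) ℕ.* doubleFactorial (+ n)
doubleFactorial -[1+ _ ]                = 1

-- Zero for a negative lower index.
binomial : ℕ → ℤ → ℕ
binomial p (+ j)    = p C j
binomial p -[1+ _ ] = 0

-- The truncated subtractions are exact for 1 ≤ k and s ≤ k.
coefficient : ℕ → ℕ → ℤ
coefficient k s =
  -1ℤ ℤ.^ (k ∸ s)
    ℤ.* + doubleFactorial (+ (2 ℕ.* k) ℤ.- + (2 ℕ.* s) ℤ.- 1ℤ)
    ℤ.* + binomial (2 ℕ.* k ∸ s ∸ 1) (+ s ℤ.- 1ℤ)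

{-# OPTIONS --safe #-}

-- Induction on k.  Differentiating the k-th sum termwise and dividing by z gives the
-- (k+1)-st sum, because the coefficients c satisfy
-- c (k+1) (s+1) = c k s - (2k - s - 1) c k (s+1), so that the remaining terms telescope.
-- For the domains: since c k k = 1, the k-th derivative of f is z^k times the difference
-- of the k-th sum and its terms of lower order, so it is differentiable wherever they are.
module Submission where

open import Defs
open import Algebra.Apartness.Bundles using (HeytingField; HeytingCommutativeRing)
import Algebra.Apartness.Properties.HeytingCommutativeRing as HeytingProperties
open import Algebra.Bundles using (CommutativeRing)
import Algebra.Definitions.RawMonoid as RawMonoidDefinitions
import Algebra.Properties.Ring as RingProperties
import Algebra.Properties.Semiring.Mult as SemiringMult
import Algebra.Properties.Semiring.Mult.TCOptimised as SemiringMultTC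
import Algebra.Solver.Ring as RingSolver
open import Algebra.Solver.Ring.AlmostCommutativeRing using (fromCommutativeRing; _-Raw-AlmostCommutative⟶_)
open import Algebra.Structures using (IsCommutativeRing)
open import Data.Fin.Base using (toℕ)
open import Data.Integer.Base as ℤ using (ℤ; +_; -[1+_])
import Data.Integer.Properties as ℤ
open import Data.Maybe.Base using (Maybe; just; nothing)
open import Data.Nat.Base as ℕ using (ℕ; zero; suc; z≤n; s≤s)
import Data.Nat.Properties as ℕ
open import Data.Product.Base using (∃-syntax; Σ-syntax; _×_; _,_; proj₁; proj₂; map₂)
open import Data.Sum.Base using (_⊎_; inj₁; inj₂; [_,_]′)
open import Data.Unit.Base using (tt)
open import Function.Base using (_∘_; id)
open import Function.Bundles using (Equivalence; mk⇔)
open import Relation.Binary.PropositionalEquality.Core as ≡ using (_≡_)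
import Relation.Binary.Reasoning.Setoid as SetoidReasoning
open import Relation.Binary.Structures using (IsStrictPartialOrder)
open import Relation.Nullary using (¬_; yes; no; contradiction)

-- The recurrence is Pascal's rule followed by absorption: with `k = n + (s + 1)`, one half of the
-- split binomial is that of `c k s`, and in the other half `(2n+1) * C(2n+1+s, s) = (2n+1+s) *
-- C(2n+s, s)` trades the new odd factor for `2k - s - 1`. The induction starts at `k = 1`: for `k =
-- 0` the only coefficient is `0`, while the zeroth power of an operator is the identity. Two
-- obstacles shape the rest. The order on the reals is not decidable and square roots are avoided,
-- so estimates are made on squared norms, with cotransitivity in place of case distinctions. And
-- the value of a partial function may depend on the proof that the argument lies in its domain;
-- hence the successive derivatives at a fixed point are collected into a plain sequence of complex
-- numbers, for which the telescoping is an identity in a commutative ring.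

-- Integers in a commutative ring, and a ring solver with integer coefficients.

module IntegerEmbedding {c ℓ} (R : CommutativeRing c ℓ) where

  open CommutativeRing R
  open RingProperties ring
  open SemiringMult semiring using (×-homo-+; ×1-homo-*) renaming (_×_ to _·_)
  open SemiringMultTC semiring using (×ᵤ≈×) renaming (_×_ to _·′_)
  open SetoidReasoning setoid

  fromℤ : ℤ → Carrier
  fromℤ (+ n)    = n · 1#
  fromℤ -[1+ n ] = - (suc n · 1#)

  fromℤ-neg : ∀ i → fromℤ (ℤ.- i) ≈ - fromℤ i
  fromℤ-neg (+ zero)  = sym -0#≈0#
  fromℤ-neg (+ suc n) = refl
  fromℤ-neg -[1+ n ]  = sym (-‿involutive _)

  -- Addition of integers of opposite sign reduces to `ℤ._⊖_`, so the sign analysis behind `fromℤ-+`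
  -- happens here.
  fromℤ-⊖ : ∀ m n → fromℤ (m ℤ.⊖ n) ≈ m · 1# - n · 1#
  fromℤ-⊖ m zero = begin
    m · 1#       ≈⟨ +-identityʳ _ ⟨
    m · 1# + 0#  ≈⟨ +-congˡ -0#≈0# ⟨
    m · 1# - 0#  ∎
  fromℤ-⊖ zero    (suc n) = sym (+-identityˡ _)
  fromℤ-⊖ (suc m) (suc n) = begin
    fromℤ (suc m ℤ.⊖ suc n)                    ≡⟨ ≡.cong fromℤ (ℤ.[1+m]⊖[1+n]≡m⊖n m n) ⟩
    fromℤ (m ℤ.⊖ n)                            ≈⟨ fromℤ-⊖ m n ⟩
    m · 1# - n · 1#                            ≈⟨ +-congʳ (xyx⁻¹≈y 1# _) ⟨
    (1# + m · 1# - 1#) - n · 1#                ≈⟨ +-assoc _ _ _ ⟩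
    (1# + m · 1#) + (- 1# - n · 1#)            ≈⟨ +-congˡ (-‿+-comm _ _) ⟩
    suc m · 1# - suc n · 1#                    ∎

  fromℤ-+ : ∀ i j → fromℤ (i ℤ.+ j) ≈ fromℤ i + fromℤ j
  fromℤ-+ (+ m)    (+ n)    = ×-homo-+ 1# m n
  fromℤ-+ (+ m)    -[1+ n ] = fromℤ-⊖ m (suc n)
  fromℤ-+ -[1+ m ] (+ n)    = trans (fromℤ-⊖ n (suc m)) (+-comm _ _)
  fromℤ-+ -[1+ m ] -[1+ n ] = begin
    - (suc (suc (m ℕ.+ n)) · 1#)        ≡⟨ ≡.cong (λ k → - (k · 1#)) (ℕ.+-suc (suc m) n) ⟨
    - ((suc m ℕ.+ suc n) · 1#)          ≈⟨ -‿cong (×-homo-+ 1# (suc m) (suc n)) ⟩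
    - (suc m · 1# + suc n · 1#)         ≈⟨ -‿+-comm _ _ ⟨
    - (suc m · 1#) - suc n · 1#         ∎

  fromℤ-* : ∀ i j → fromℤ (i ℤ.* j) ≈ fromℤ i * fromℤ j
  fromℤ-*⁺ : ∀ i n → fromℤ (i ℤ.* + n) ≈ fromℤ i * n · 1#
  fromℤ-*⁺ (+ m)    n = begin
    fromℤ (+ m ℤ.* + n)     ≡⟨ ≡.cong fromℤ (ℤ.pos-* m n) ⟨
    (m ℕ.* n) · 1#          ≈⟨ ×1-homo-* m n ⟩
    m · 1# * n · 1#         ∎
  fromℤ-*⁺ -[1+ m ] n = begin
    fromℤ (ℤ.- (+ suc m) ℤ.* + n)     ≡⟨ ≡.cong fromℤ (ℤ.neg-distribˡ-* (+ suc m) (+ n)) ⟨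
    fromℤ (ℤ.- (+ suc m ℤ.* + n))     ≈⟨ fromℤ-neg (+ suc m ℤ.* + n) ⟩
    - fromℤ (+ suc m ℤ.* + n)         ≈⟨ -‿cong (fromℤ-*⁺ (+ suc m) n) ⟩
    - (suc m · 1# * n · 1#)           ≈⟨ -‿distribˡ-* _ _ ⟩
    - (suc m · 1#) * n · 1#           ∎
  fromℤ-* i (+ n)    = fromℤ-*⁺ i n
  fromℤ-* i -[1+ n ] = begin
    fromℤ (i ℤ.* ℤ.- (+ suc n))       ≡⟨ ≡.cong fromℤ (ℤ.neg-distribʳ-* i (+ suc n)) ⟨
    fromℤ (ℤ.- (i ℤ.* + suc n))       ≈⟨ fromℤ-neg (i ℤ.* + suc n) ⟩
    - fromℤ (i ℤ.* + suc n)           ≈⟨ -‿cong (fromℤ-*⁺ i (suc n)) ⟩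
    - (fromℤ i * suc n · 1#)          ≈⟨ -‿distribʳ-* _ _ ⟩
    fromℤ i * - (suc n · 1#)          ∎

  -- Unlike fromℤ this maps 1ℤ to 1# definitionally, so that numerals in
  -- equations passed to the ring solver read back as written.
  private
    ⟦_⟧ℤ : ℤ → Carrier
    ⟦ + n ⟧ℤ      = n ·′ 1#
    ⟦ -[1+ n ] ⟧ℤ = - (suc n ·′ 1#)

    fromℤ≈⟦⟧ : ∀ i → fromℤ i ≈ ⟦ i ⟧ℤ
    fromℤ≈⟦⟧ (+ n)    = ×ᵤ≈× n 1#
    fromℤ≈⟦⟧ -[1+ n ] = -‿cong (×ᵤ≈× (suc n) 1#)

    ℤ-morphism : ℤ.+-*-rawRing -Raw-AlmostCommutative⟶ fromCommutativeRing R
    ℤ-morphism = record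
      { ⟦_⟧    = ⟦_⟧ℤ
      ; +-homo = λ i j → trans (sym (fromℤ≈⟦⟧ (i ℤ.+ j)))
                   (trans (fromℤ-+ i j) (+-cong (fromℤ≈⟦⟧ i) (fromℤ≈⟦⟧ j)))
      ; *-homo = λ i j → trans (sym (fromℤ≈⟦⟧ (i ℤ.* j)))
                   (trans (fromℤ-* i j) (*-cong (fromℤ≈⟦⟧ i) (fromℤ≈⟦⟧ j)))
      ; -‿homo = λ i → trans (sym (fromℤ≈⟦⟧ (ℤ.- i)))
                   (trans (fromℤ-neg i) (-‿cong (fromℤ≈⟦⟧ i)))
      ; 0-homo = refl
      ; 1-homo = refl
      }

    _≟?_ : ∀ i j → Maybe (⟦ i ⟧ℤ ≈ ⟦ j ⟧ℤ)
    i ≟? j with i ℤ.≟ j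
    ... | yes ≡.refl = just refl
    ... | no  _      = nothing

  module Solver = RingSolver ℤ.+-*-rawRing (fromCommutativeRing R) ℤ-morphism _≟?_

-- Constructive ordered fields.

module OrderedFieldProperties (F : OrderedField) where

  open OrderedField F

  heytingRing : HeytingCommutativeRing _ _ _
  heytingRing = HeytingField.heytingCommutativeRing heytingField

  commutativeRing : CommutativeRing _ _
  commutativeRing = HeytingCommutativeRing.commutativeRing heytingRing

  open HeytingProperties heytingRing using (1#0; x-0≈x; invertibleˡ⇒#)
  open IntegerEmbedding commutativeRing using (module Solver)
  open IsStrictPartialOrder isStrictPartialOrder public
    using () renaming (irrefl to <-irrefl; trans to <-trans; <-respʳ-≈ to <-respʳ; <-respˡ-≈ to <-respˡ)
  open Solver

  opaque
    <-resp : ∀ {x x′ y y′} → x ≈ x′ → y ≈ y′ → x < y → x′ < y′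
    <-resp p q = <-respʳ q ∘ <-respˡ p

    <⇒0<- : ∀ {x y} → x < y → 0# < y - x
    <⇒0<- {x} {y} = <-respˡ (-‿inverseʳ x) ∘ +-monoˡ-< x y (- x)

    0<-⇒< : ∀ {x y} → 0# < y - x → x < y
    0<-⇒< {x} {y} = <-resp (+-identityˡ x)
      (solve 2 (λ x y → y :- x :+ x := y) refl x y) ∘ +-monoˡ-< 0# (y - x) x

    +-pos : ∀ {x y} → 0# < x → 0# < y → 0# < x + y
    +-pos {x} {y} 0<x 0<y =
      <-trans 0<y (<-respˡ (+-identityˡ y) (+-monoˡ-< 0# x y 0<x))

    +-mono-< : ∀ {x x′ y y′} → x < x′ → y < y′ → x + y < x′ + y′
    +-mono-< {x} {x′} {y} {y′} x<x′ y<y′ = 0<-⇒< (<-respʳ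
      (solve 4 (λ x x′ y y′ → (x′ :- x) :+ (y′ :- y) := (x′ :+ y′) :- (x :+ y)) refl x x′ y y′)
      (+-pos (<⇒0<- x<x′) (<⇒0<- y<y′)))

    *-monoˡ-< : ∀ {x y z} → 0# < z → x < y → x * z < y * z
    *-monoˡ-< {x} {y} {z} 0<z x<y = 0<-⇒< (<-respʳ
      (solve 3 (λ x y z → (y :- x) :* z := y :* z :- x :* z) refl x y z)
      (*-pos (y - x) z (<⇒0<- x<y) 0<z))

    #0⇒sq-pos : ∀ {x} → x # 0# → 0# < x * x
    #0⇒sq-pos {x} x#0 with Equivalence.to (#⇔<⊎> x 0#) x#0
    ... | inj₂ 0<x = *-pos x x 0<x 0<x
    ... | inj₁ x<0 = <-respʳ
      (solve 1 (λ x → (con ℤ.0ℤ :- x) :* (con ℤ.0ℤ :- x) := x :* x) refl x)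
      (*-pos (0# - x) (0# - x) (<⇒0<- x<0) (<⇒0<- x<0))

    0<1 : 0# < 1#
    0<1 = <-respʳ (*-identityˡ 1#) (#0⇒sq-pos 1#0)

    pos⇒#0 : ∀ {x} → 0# < x → x # 0#
    pos⇒#0 0<x = Equivalence.from (#⇔<⊎> _ _) (inj₂ 0<x)

    <-asym : ∀ {x y} → x < y → ¬ y < x
    <-asym x<y y<x = <-irrefl refl (<-trans x<y y<x)

    -- Cotransitivity of `#` supplies the split; an inequality in the wrong direction is chained
    -- with `x < y` to reach the other alternative. This stands in for decidability of `<` in the
    -- estimates below.
    <-cotrans : ∀ {x y} → x < y → ∀ z → x < z ⊎ z < y
    <-cotrans {x} {y} x<y z with #-cotrans (Equivalence.from (#⇔<⊎> x y) (inj₁ x<y)) z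
    ... | inj₁ x#z = [ inj₁ , (λ z<x → inj₂ (<-trans z<x x<y)) ]′ (Equivalence.to (#⇔<⊎> x z) x#z)
    ... | inj₂ z#y = [ inj₂ , (λ y<z → inj₁ (<-trans x<y y<z)) ]′ (Equivalence.to (#⇔<⊎> z y) z#y)

  infix 4 _≤_
  -- The negative form lets squares be nonnegative without deciding whether `x` is zero, and
  -- cotransitivity makes it compose with `<`.
  _≤_ : Carrier → Carrier → Set
  x ≤ y = ¬ y < x

  opaque
    ≤-<-trans : ∀ {x y z} → x ≤ y → y < z → x < z
    ≤-<-trans {x} x≤y y<z with <-cotrans y<z x
    ... | inj₁ y<x = contradiction y<x x≤y
    ... | inj₂ x<z = x<z

    <-≤-trans : ∀ {x y z} → x < y → y ≤ z → x < z
    <-≤-trans {z = z} x<y y≤z with <-cotrans x<y z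
    ... | inj₁ x<z = x<z
    ... | inj₂ z<y = contradiction z<y y≤z

    -- An inverse `i` of `x * y` makes `i * x` an inverse of `y`, so `y` is apart from zero; a
    -- negative `y` would make the product negative.
    *-cancel-pos : ∀ {x y} → 0# < x → 0# < x * y → 0# < y
    *-cancel-pos {x} {y} 0<x 0<xy with Equivalence.to (#⇔<⊎> y 0#) y#0
      where
      y#0 : y # 0#
      y#0 with #⇒invertible (pos⇒#0 0<xy)
      ... | i , i*xy≈1 , _ = invertibleˡ⇒# (i * x , trans
        (solve 3 (λ i x y → i :* x :* (y :- con ℤ.0ℤ) := i :* (x :* y :- con ℤ.0ℤ)) refl i x y) i*xy≈1)
    ... | inj₂ 0<y = 0<y
    ... | inj₁ y<0 = contradiction
      (<-resp (*-comm y x) (zeroˡ x) (*-monoˡ-< 0<x y<0)) (<-asym 0<xy)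

  infix 9 _⁻¹⟨_⟩
  opaque
    _⁻¹⟨_⟩ : ∀ x → 0# < x → Carrier
    x ⁻¹⟨ 0<x ⟩ = proj₁ (#⇒invertible (pos⇒#0 0<x))

    *-⁻¹ : ∀ x (0<x : 0# < x) → x * x ⁻¹⟨ 0<x ⟩ ≈ 1#
    *-⁻¹ x 0<x = trans (*-congʳ (sym (x-0≈x x))) (proj₂ (proj₂ (#⇒invertible (pos⇒#0 0<x))))

    ⁻¹-pos : ∀ {x} (0<x : 0# < x) → 0# < x ⁻¹⟨ 0<x ⟩
    ⁻¹-pos {x} 0<x = *-cancel-pos 0<x (<-respʳ (sym (*-⁻¹ x 0<x)) 0<1)

    -- A negative square would be invertible, which makes `x` itself apart from zero and so its
    -- square positive.
    0≤sq : ∀ x → 0# ≤ x * x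
    0≤sq x x²<0 = <-asym x²<0 (#0⇒sq-pos x#0)
      where
      x#0 : x # 0#
      x#0 with #⇒invertible (Equivalence.from (#⇔<⊎> _ _) (inj₁ x²<0))
      ... | i , i*x²≈1 , _ = invertibleˡ⇒# (i * x , trans
        (solve 2 (λ i x → i :* x :* (x :- con ℤ.0ℤ) := i :* (x :* x :- con ℤ.0ℤ)) refl i x) i*x²≈1)

    +-nonneg : ∀ {x y} → 0# ≤ x → 0# ≤ y → 0# ≤ x + y
    +-nonneg {x} {y} 0≤x 0≤y x+y<0 with <-cotrans x+y<0 y
    ... | inj₂ y<0 = 0≤y y<0
    ... | inj₁ x+y<y = 0≤x (<-resp
      (solve 2 (λ x y → x :+ y :- y := x) refl x y) (-‿inverseʳ y) (+-monoˡ-< (x + y) y (- y) x+y<y))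

    -- The chain passes through `x * y′`. Its first step is only `≤`, since `x` may be zero; in the
    -- second, `y′` is positive because it exceeds `y`.
    *-mono-< : ∀ {x x′ y y′} → 0# ≤ x → 0# ≤ y → x < x′ → y < y′ → x * y < x′ * y′
    *-mono-< {x} {x′} {y} {y′} 0≤x 0≤y x<x′ y<y′ =
      ≤-<-trans xy≤xy′ (*-monoˡ-< (≤-<-trans 0≤y y<y′) x<x′)
      where
      xy≤xy′ : x * y ≤ x * y′
      xy≤xy′ xy′<xy = 0≤x (0<-⇒< (*-cancel-pos (<⇒0<- y<y′) (<-respʳ
        (solve 3 (λ x y y′ → x :* y :- x :* y′ := (y′ :- y) :* (con ℤ.0ℤ :- x)) refl x y y′)
        (<⇒0<- xy′<xy))))

    sq-mono-< : ∀ {x y} → 0# < x → x < y → x * x < y * y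
    sq-mono-< 0<x x<y = *-mono-< (<-asym 0<x) (<-asym 0<x) x<y x<y

  2# : Carrier
  2# = 1# + 1#

  opaque
    0<2 : 0# < 2#
    0<2 = +-pos 0<1 0<1

    half : Carrier → Carrier
    half x = x * 2# ⁻¹⟨ 0<2 ⟩

    half-double : ∀ x → half x + half x ≈ x
    half-double x = trans
      (solve 2 (λ x h → x :* h :+ x :* h := x :* ((con ℤ.1ℤ :+ con ℤ.1ℤ) :* h)) refl x _)
      (trans (*-congˡ (*-⁻¹ 2# 0<2)) (*-identityʳ x))

    half-pos : ∀ {x} → 0# < x → 0# < half x
    half-pos 0<x = *-pos _ _ 0<x (⁻¹-pos 0<2)

    half-< : ∀ {x} → 0# < x → half x < x
    half-< {x} 0<x = <-resp (+-identityˡ _) (half-double x)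
      (+-monoˡ-< 0# (half x) (half x) (half-pos 0<x))

  -- < is not decidable, so there is no minimum to take.
  opaque
    lower-bound : ∀ {x y} → 0# < x → 0# < y → ∃[ z ] 0# < z × z < x × z < y
    lower-bound {x} {y} 0<x 0<y with <-cotrans (half-< 0<x) y
    ... | inj₁ hx<y = half x , half-pos 0<x , half-< 0<x , hx<y
    ... | inj₂ y<x  = half y , half-pos 0<y , <-trans (half-< 0<y) y<x , half-< 0<y

  opaque
    -- Any positive `z` below both `x` and `1#` will do, as then `z * z < x * 1#`. This takes the
    -- place of a square root when a radius is chosen.
    small-square : ∀ {x} → 0# < x → ∃[ z ] 0# < z × z * z < x
    small-square {x} 0<x with lower-bound 0<x 0<1
    ... | z , 0<z , z<x , z<1 = z , 0<z , <-respʳ (*-identityʳ x)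
      (*-mono-< (<-asym 0<z) (<-asym 0<z) z<x z<1)

  opaque
    -- By tightness it suffices to refute `x # 0#`, and a positive `x` has a positive square below
    -- it.
    <sq⇒≈0 : ∀ {x} → 0# ≤ x → (∀ ε → 0# < ε → x < ε * ε) → x ≈ 0#
    <sq⇒≈0 {x} 0≤x x<ε² = proj₁ (tight x 0#) λ x#0 →
      [ 0≤x , positive ]′ (Equivalence.to (#⇔<⊎> x 0#) x#0)
      where
      positive : ¬ 0# < x
      positive 0<x with small-square 0<x
      ... | ε , 0<ε , ε²<x = <-asym (x<ε² ε 0<ε) ε²<x

-- Complex numbers: ring structure, squared norm and inverse.

module ComplexProperties (R : Reals) where

  open Operators R public
  module ℝ where
    open Reals R public
    open OrderedFieldProperties orderedField public
  open ℝ using () renaming (Carrier to ℝ)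
  open IntegerEmbedding ℝ.commutativeRing public using () renaming (module Solver to ℝ-Solver)

  opaque
    ℂ-isCommutativeRing : IsCommutativeRing _≈_ _+_ _*_ -_ 0# 1#
    ℂ-isCommutativeRing = record
      { isRing = record
        { +-isAbelianGroup = record
          { isGroup = record
            { isMonoid = record
              { isSemigroup = record
                { isMagma = record
                  { isEquivalence = record
                    { refl  = ℝ.refl , ℝ.refl
                    ; sym   = λ (p , q) → ℝ.sym p , ℝ.sym q
                    ; trans = λ (p , q) (p′ , q′) → ℝ.trans p p′ , ℝ.trans q q′
                    }
                  ; ∙-cong = λ (p , q) (p′ , q′) → ℝ.+-cong p p′ , ℝ.+-cong q q′
                  }
                ; assoc = λ _ _ _ → ℝ.+-assoc _ _ _ , ℝ.+-assoc _ _ _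
                }
              ; identity = (λ _ → ℝ.+-identityˡ _ , ℝ.+-identityˡ _)
                         , (λ _ → ℝ.+-identityʳ _ , ℝ.+-identityʳ _)
              }
            ; inverse = (λ _ → ℝ.-‿inverseˡ _ , ℝ.-‿inverseˡ _)
                      , (λ _ → ℝ.-‿inverseʳ _ , ℝ.-‿inverseʳ _)
            ; ⁻¹-cong = λ (p , q) → ℝ.-‿cong p , ℝ.-‿cong q
            }
          ; comm = λ _ _ → ℝ.+-comm _ _ , ℝ.+-comm _ _
          }
        ; *-cong = λ (p , q) (p′ , q′) →
            ℝ.+-cong (ℝ.*-cong p p′) (ℝ.-‿cong (ℝ.*-cong q q′)) ,
            ℝ.+-cong (ℝ.*-cong p q′) (ℝ.*-cong q p′)
        ; *-assoc = λ (a +i b) (c +i d) (e +i f) →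
            solve 6 (λ a b c d e f →
              (a :* c :- b :* d) :* e :- (a :* d :+ b :* c) :* f :=
              a :* (c :* e :- d :* f) :- b :* (c :* f :+ d :* e)) ℝ.refl a b c d e f ,
            solve 6 (λ a b c d e f →
              (a :* c :- b :* d) :* f :+ (a :* d :+ b :* c) :* e :=
              a :* (c :* f :+ d :* e) :+ b :* (c :* e :- d :* f)) ℝ.refl a b c d e f
        ; *-identity =
            (λ (a +i b) →
              solve 2 (λ a b → :1 :* a :- :0 :* b := a) ℝ.refl a b ,
              solve 2 (λ a b → :1 :* b :+ :0 :* a := b) ℝ.refl a b) ,
            (λ (a +i b) →
              solve 2 (λ a b → a :* :1 :- b :* :0 := a) ℝ.refl a b ,
              solve 2 (λ a b → a :* :0 :+ b :* :1 := b) ℝ.refl a b)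
        ; distrib =
            (λ (a +i b) (c +i d) (e +i f) →
              solve 6 (λ a b c d e f → a :* (c :+ e) :- b :* (d :+ f) :=
                (a :* c :- b :* d) :+ (a :* e :- b :* f)) ℝ.refl a b c d e f ,
              solve 6 (λ a b c d e f → a :* (d :+ f) :+ b :* (c :+ e) :=
                (a :* d :+ b :* c) :+ (a :* f :+ b :* e)) ℝ.refl a b c d e f) ,
            (λ (a +i b) (c +i d) (e +i f) →
              solve 6 (λ a b c d e f → (c :+ e) :* a :- (d :+ f) :* b :=
                (c :* a :- d :* b) :+ (e :* a :- f :* b)) ℝ.refl a b c d e f ,
              solve 6 (λ a b c d e f → (c :+ e) :* b :+ (d :+ f) :* a :=
                (c :* b :+ d :* a) :+ (e :* b :+ f :* a)) ℝ.refl a b c d e f)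
        }
      ; *-comm = λ (a +i b) (c +i d) →
          solve 4 (λ a b c d → a :* c :- b :* d := c :* a :- d :* b) ℝ.refl a b c d ,
          solve 4 (λ a b c d → a :* d :+ b :* c := c :* b :+ d :* a) ℝ.refl a b c d
      }
      where
      open ℝ-Solver
      :0 :1 : ∀ {n} → Polynomial n
      :0 = con ℤ.0ℤ
      :1 = con ℤ.1ℤ

  ℂ-commutativeRing : CommutativeRing _ _
  ℂ-commutativeRing = record { isCommutativeRing = ℂ-isCommutativeRing }

  open CommutativeRing ℂ-commutativeRing public using
    ( setoid; reflexive; refl; sym; trans
    ; +-cong; +-congˡ; +-congʳ; +-comm; +-assoc; +-identityʳ; -‿cong; -‿inverseʳ
    ; *-cong; *-congˡ; *-congʳ; *-comm; *-assoc; *-identityˡ; *-identityʳ; zeroˡ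
    )
  open IntegerEmbedding ℂ-commutativeRing public using () renaming (module Solver to ℂ-Solver)

  opaque
    ∣∣²-cong : ∀ {z w} → z ≈ w → ∣ z ∣² ℝ.≈ ∣ w ∣²
    ∣∣²-cong (p , q) = ℝ.+-cong (ℝ.*-cong p p) (ℝ.*-cong q q)

    ∣∣²-* : ∀ z w → ∣ z * w ∣² ℝ.≈ ∣ z ∣² ℝ.* ∣ w ∣²
    ∣∣²-* (a +i b) (c +i d) = solve 4 (λ a b c d →
      (a :* c :- b :* d) :* (a :* c :- b :* d) :+ (a :* d :+ b :* c) :* (a :* d :+ b :* c) :=
      (a :* a :+ b :* b) :* (c :* c :+ d :* d)) ℝ.refl a b c d
      where open ℝ-Solver

    ∣∣²-neg : ∀ z → ∣ - z ∣² ℝ.≈ ∣ z ∣²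
    ∣∣²-neg (a +i b) = solve 2 (λ a b → :- a :* :- a :+ :- b :* :- b := a :* a :+ b :* b) ℝ.refl a b
      where open ℝ-Solver

    -- The parallelogram law, arranged so that nonnegativity of the right-hand side bounds
    -- `∣ z + w ∣²` by twice `∣ z ∣² + ∣ w ∣²`.
    parallelogram : ∀ z w →
      (∣ z ∣² ℝ.+ ∣ w ∣²) ℝ.+ (∣ z ∣² ℝ.+ ∣ w ∣²) ℝ.- ∣ z + w ∣² ℝ.≈ ∣ z - w ∣²
    parallelogram (a +i b) (c +i d) = solve 4 (λ a b c d →
      ((a :* a :+ b :* b) :+ (c :* c :+ d :* d)) :+ ((a :* a :+ b :* b) :+ (c :* c :+ d :* d))
        :- ((a :+ c) :* (a :+ c) :+ (b :+ d) :* (b :+ d)) :=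
      (a :- c) :* (a :- c) :+ (b :- d) :* (b :- d)) ℝ.refl a b c d
      where open ℝ-Solver

    0≤∣∣² : ∀ z → ℝ.0# ℝ.≤ ∣ z ∣²
    0≤∣∣² z = ℝ.+-nonneg (ℝ.0≤sq _) (ℝ.0≤sq _)

    ∣0∣²≈0 : ∣ 0# ∣² ℝ.≈ ℝ.0#
    ∣0∣²≈0 = solve 0 (con ℤ.0ℤ :* con ℤ.0ℤ :+ con ℤ.0ℤ :* con ℤ.0ℤ := con ℤ.0ℤ) ℝ.refl
      where open ℝ-Solver

  -- With squared norms, this weak form replaces the triangle inequality.
  opaque
    ∣+∣²< : ∀ {z w x y} → ∣ z ∣² ℝ.< x → ∣ w ∣² ℝ.< y → ∣ z + w ∣² ℝ.< (x ℝ.+ y) ℝ.+ (x ℝ.+ y)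
    ∣+∣²< {z} {w} p q = ℝ.≤-<-trans
      (λ lt → 0≤∣∣² (z - w) (ℝ.<-respˡ (parallelogram z w) (ℝ.<-respʳ (ℝ.-‿inverseʳ _)
        (ℝ.+-monoˡ-< _ _ (ℝ.- ∣ z + w ∣²) lt))))
      (ℝ.+-mono-< (ℝ.+-mono-< p q) (ℝ.+-mono-< p q))

  opaque
    ∣∣<-cong : ∀ {z w ε} → z ≈ w → ∣ z ∣< ε → ∣ w ∣< ε
    ∣∣<-cong z≈w = ℝ.<-respˡ (∣∣²-cong z≈w)

    ∣∣<-mono : ∀ {z δ ε} → ℝ.0# ℝ.< δ → δ ℝ.< ε → ∣ z ∣< δ → ∣ z ∣< ε
    ∣∣<-mono 0<δ δ<ε z<δ = ℝ.<-trans z<δ (ℝ.sq-mono-< 0<δ δ<ε)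

    -- The two squared bounds are each a quarter of `ε * ε`, and `∣+∣²<` doubles their sum, which
    -- gives `ε * ε` exactly.
    ∣∣<-+ : ∀ {z w} ε → ∣ z ∣< ℝ.half ε → ∣ w ∣< ℝ.half ε → ∣ z + w ∣< ε
    ∣∣<-+ ε p q = ℝ.<-respʳ
      (ℝ.trans (solve 1 (λ h → (h :* h :+ h :* h) :+ (h :* h :+ h :* h) := (h :+ h) :* (h :+ h))
        ℝ.refl (ℝ.half ε)) (ℝ.*-cong (ℝ.half-double ε) (ℝ.half-double ε)))
      (∣+∣²< p q)
      where open ℝ-Solver

    ∣∣²<-* : ∀ {z w x y} → ∣ z ∣² ℝ.< x → ∣ w ∣² ℝ.< y → ∣ z * w ∣² ℝ.< x ℝ.* y
    ∣∣²<-* {z} {w} p q = ℝ.<-respˡ (ℝ.sym (∣∣²-* z w)) (ℝ.*-mono-< (0≤∣∣² z) (0≤∣∣² w) p q)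

    ∣0∣< : ∀ {ε} → ℝ.0# ℝ.< ε → ∣ 0# ∣< ε
    ∣0∣< 0<ε = ℝ.<-respˡ (ℝ.sym ∣0∣²≈0) (ℝ.*-pos _ _ 0<ε 0<ε)

    ∣∣<⇒≈0 : ∀ {z} → (∀ ε → ℝ.0# ℝ.< ε → ∣ z ∣< ε) → z ≈ 0#
    ∣∣<⇒≈0 {z} small = sq≈0 (re z) (im z) small , sq≈0 (im z) (re z) λ ε 0<ε →
      ℝ.<-respˡ (ℝ.+-comm _ _) (small ε 0<ε)
      where
      sq≈0 : ∀ x y → (∀ ε → ℝ.0# ℝ.< ε → x ℝ.* x ℝ.+ y ℝ.* y ℝ.< ε ℝ.* ε) → x ℝ.≈ ℝ.0#
      sq≈0 x y small = proj₁ (ℝ.tight x ℝ.0#) λ x#0 →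
        ℝ.<-irrefl (ℝ.sym sum≈0) (ℝ.≤-<-trans (ℝ.0≤sq y) (ℝ.<-respˡ (ℝ.+-identityˡ _)
          (ℝ.+-monoˡ-< _ _ (y ℝ.* y) (ℝ.#0⇒sq-pos x#0))))
        where
        sum≈0 : x ℝ.* x ℝ.+ y ℝ.* y ℝ.≈ ℝ.0#
        sum≈0 = ℝ.<sq⇒≈0 (ℝ.+-nonneg (ℝ.0≤sq x) (ℝ.0≤sq y)) small

  opaque
    inverseˡ : ∀ z p → inverse z p * z ≈ 1#
    inverseˡ z p =
        inv _ _ _ (proj₁ (proj₂ (ℝ.#⇒invertible (Equivalence.from (ℝ.#⇔<⊎> _ _) (inj₂ p))))) ,
        inv′ _ _ _
      where
      open ℝ-Solver
      inv : ∀ x y n → n ℝ.* (x ℝ.* x ℝ.+ y ℝ.* y ℝ.- ℝ.0#) ℝ.≈ ℝ.1# →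
            x ℝ.* n ℝ.* x ℝ.- (ℝ.- y ℝ.* n) ℝ.* y ℝ.≈ ℝ.1#
      inv x y n = ℝ.trans (solve 3 (λ x y n → x :* n :* x :- (:- y :* n) :* y :=
        n :* (x :* x :+ y :* y :- con ℤ.0ℤ)) ℝ.refl x y n)
      inv′ : ∀ x y n → x ℝ.* n ℝ.* y ℝ.+ (ℝ.- y ℝ.* n) ℝ.* x ℝ.≈ ℝ.0#
      inv′ = solve 3 (λ x y n → x :* n :* y :+ (:- y :* n) :* x := con ℤ.0ℤ) ℝ.refl

    -- Uniqueness of inverses. It is needed even for `z` and `w` identical, since `p` and `q` may
    -- yield different reciprocals of the norm.
    inverse-cong : ∀ {z w} p q → z ≈ w → inverse z p ≈ inverse w q
    inverse-cong {z} {w} p q z≈w = begin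
      inverse z p                      ≈⟨ *-identityʳ _ ⟨
      inverse z p * 1#                 ≈⟨ *-congˡ (trans (*-comm _ _) (inverseˡ w q)) ⟨
      inverse z p * (w * inverse w q)  ≈⟨ *-assoc _ _ _ ⟨
      inverse z p * w * inverse w q    ≈⟨ *-congʳ (*-congˡ z≈w) ⟨
      inverse z p * z * inverse w q    ≈⟨ *-congʳ (inverseˡ z p) ⟩
      1# * inverse w q                 ≈⟨ *-identityˡ _ ⟩
      inverse w q                      ∎
      where open SetoidReasoning setoid

  -- Neighbourhoods and limits of partially defined functions.

  Near : ∀ {ℓ} → ℂ → (ℂ → Set ℓ) → Set ℓ
  Near a Q = ∃[ δ ] (ℝ.0# ℝ.< δ) × (∀ z → ∣ z - a ∣< δ → Q z)

  near-map : ∀ {ℓ ℓ′} {a} {P : ℂ → Set ℓ} {Q : ℂ → Set ℓ′} → (∀ z → P z → Q z) → Near a P → Near a Q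
  near-map f (δ , 0<δ , p) = δ , 0<δ , λ z → f z ∘ p z

  opaque
    near-× : ∀ {ℓ ℓ′} {a} {P : ℂ → Set ℓ} {Q : ℂ → Set ℓ′} → Near a P → Near a Q →
      Near a (λ z → P z × Q z)
    near-× (δ₁ , 0<δ₁ , p) (δ₂ , 0<δ₂ , q) = let δ , 0<δ , δ<δ₁ , δ<δ₂ = ℝ.lower-bound 0<δ₁ 0<δ₂ in
      δ , 0<δ , λ z z<δ → p z (∣∣<-mono {z - _} 0<δ δ<δ₁ z<δ) , q z (∣∣<-mono {z - _} 0<δ δ<δ₂ z<δ)

    near-at : ∀ {ℓ} {a} {P : ℂ → Set ℓ} → Near a P → P a
    near-at {a = a} (δ , 0<δ , p) = p a (∣∣<-cong (sym (-‿inverseʳ a)) (∣0∣< 0<δ))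

    near-disc : ∀ a {δ} → ℝ.0# ℝ.< δ → Near a (λ z → ∣ z - a ∣< δ)
    near-disc a {δ} 0<δ = δ , 0<δ , λ _ → id

    -- The witness is `a` shifted by half the radius along the real axis. It makes every point a
    -- limit point of its neighbourhoods, on which uniqueness of derivatives rests.
    near-punctured : ∀ {ℓ} {a} {P : ℂ → Set ℓ} → Near a P → ∃[ z ] NonZero (z - a) × P z
    near-punctured {a = a@(x +i y)} (δ , 0<δ , p) =
      let h = ℝ.half δ
          0<h² = ℝ.*-pos h h (ℝ.half-pos 0<δ) (ℝ.half-pos 0<δ)
          ∣h∣² = solve 3 (λ x y h → h :* h := (x :+ h :- x) :* (x :+ h :- x) :+ (y :- y) :* (y :- y)) ℝ.refl x y h
      in (x ℝ.+ h) +i y , ℝ.<-respʳ ∣h∣² 0<h² ,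
         p _ (ℝ.<-respˡ ∣h∣² (ℝ.sq-mono-< (ℝ.half-pos 0<δ) (ℝ.half-< 0<δ)))
      where open ℝ-Solver

  -- h is defined only where a proof of P is at hand; the value may depend on it.
  Family : (ℂ → Set) → Set
  Family P = ∀ z → P z → ℂ

  Vanishes : ∀ {P} → ℂ → Family P → Set
  Vanishes a h = ∀ ε → ℝ.0# ℝ.< ε → Near a (λ z → ∀ p → ∣ h z p ∣< ε)

  Bounded : ∀ {P} → ℂ → Family P → Set
  Bounded a h = ∃[ B ] (ℝ.0# ℝ.< B) × Near a (λ z → ∀ p → ∣ h z p ∣² ℝ.< B)

  module _ {a : ℂ} where

    -- Domains are transported from `Q` back to `P`, so that a limit can be restricted to a smaller
    -- domain, such as that of a sum or product.
    vanishes-map : ∀ {P Q} {h : Family P} {k : Family Q} →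
      Near a (λ z → (q : Q z) → Σ[ p ∈ P z ] h z p ≈ k z q) → Vanishes a h → Vanishes a k
    vanishes-map n v ε 0<ε = near-map
      (λ z (e , b) q → ∣∣<-cong (proj₂ (e q)) (b (proj₁ (e q)))) (near-× n (v ε 0<ε))

    vanishes-+ : ∀ {P} {h k : Family P} → Vanishes a h → Vanishes a k → Vanishes a (λ z p → h z p + k z p)
    vanishes-+ v w ε 0<ε = near-map (λ z (p , q) r → ∣∣<-+ ε (p r) (q r))
      (near-× (v _ (ℝ.half-pos 0<ε)) (w _ (ℝ.half-pos 0<ε)))

    opaque
      vanishes-*-bounded : ∀ {P} {h k : Family P} →
        Vanishes a h → Bounded a k → Vanishes a (λ z p → h z p * k z p)
      vanishes-*-bounded v (B , 0<B , b) ε 0<ε =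
        -- With `c * c` below `1/B`, a bound `ε * c` on the first factor keeps the squared norm of
        -- the product below `ε² c² B`, hence below `ε * ε`.
        let c , 0<c , c²<B⁻¹ = ℝ.small-square (ℝ.⁻¹-pos 0<B)
            0<ε² = ℝ.*-pos ε ε 0<ε 0<ε
            bound : (ε ℝ.* c) ℝ.* (ε ℝ.* c) ℝ.* B ℝ.< ε ℝ.* ε
            bound = ℝ.<-resp
              (solve 3 (λ ε c B → c :* c :* (ε :* ε :* B) := (ε :* c) :* (ε :* c) :* B) ℝ.refl ε c B)
              (ℝ.trans (solve 3 (λ ε B i → i :* (ε :* ε :* B) := ε :* ε :* (B :* i)) ℝ.refl ε B _)
                (ℝ.trans (ℝ.*-congˡ (ℝ.*-⁻¹ B 0<B)) (ℝ.*-identityʳ _)))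
              (ℝ.*-monoˡ-< (ℝ.*-pos _ _ 0<ε² 0<B) c²<B⁻¹)
        in near-map (λ z (p , q) r → ℝ.<-trans (∣∣²<-* (p r) (q r)) bound)
             (near-× (v (ε ℝ.* c) (ℝ.*-pos _ _ 0<ε 0<c)) b)
        where open ℝ-Solver

      bounded-const : ∀ {P} w → Bounded {P} a (λ _ _ → w)
      bounded-const w = ∣ w ∣² ℝ.+ ℝ.1# , ℝ.≤-<-trans (0≤∣∣² w) lt ,
        near-map (λ _ _ _ → lt) (near-disc a ℝ.0<1)
        where
        lt : ∣ w ∣² ℝ.< ∣ w ∣² ℝ.+ ℝ.1#
        lt = ℝ.<-resp (ℝ.+-identityˡ _) (ℝ.+-comm _ _) (ℝ.+-monoˡ-< _ _ ∣ w ∣² ℝ.0<1)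

      vanishes⇒bounded : ∀ {P} {h : Family P} → Vanishes a h → Bounded a h
      vanishes⇒bounded v = ℝ.1# ℝ.* ℝ.1# , ℝ.*-pos _ _ ℝ.0<1 ℝ.0<1 , v ℝ.1# ℝ.0<1

      bounded-* : ∀ {P} {h k : Family P} → Bounded a h → Bounded a k → Bounded a (λ z p → h z p * k z p)
      bounded-* (B , 0<B , b) (C , 0<C , c) = B ℝ.* C , ℝ.*-pos _ _ 0<B 0<C ,
        near-map (λ z (p , q) r → ∣∣²<-* (p r) (q r)) (near-× b c)

      bounded-+ : ∀ {P} {h k : Family P} → Bounded a h → Bounded a k → Bounded a (λ z p → h z p + k z p)
      bounded-+ (B , 0<B , b) (C , 0<C , c) = _ , ℝ.+-pos (ℝ.+-pos 0<B 0<C) (ℝ.+-pos 0<B 0<C) ,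
        near-map (λ z (p , q) r → ∣+∣²< (p r) (q r)) (near-× b c)

  Tendsto : ∀ {P} → ℂ → Family P → ℂ → Set
  Tendsto a h w = Vanishes a (λ z p → h z p - w)

  everywhere : ∀ {ℓ} {a} {Q : ℂ → Set ℓ} → (∀ z → Q z) → Near a Q
  everywhere q = ℝ.1# , ℝ.0<1 , λ z _ → q z

  module _ {a : ℂ} where

    tendsto-map : ∀ {P Q} {h : Family P} {k : Family Q} {v w} →
      Near a (λ z → (q : Q z) → Σ[ p ∈ P z ] h z p ≈ k z q) → v ≈ w → Tendsto a h v → Tendsto a k w
    tendsto-map n v≈w = vanishes-map (near-map (λ z e q → map₂ (λ p → +-cong p (-‿cong v≈w)) (e q)) n)

    tendsto-cong : ∀ {P} {h k : Family P} {v w} →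
      (∀ z p → h z p ≈ k z p) → v ≈ w → Tendsto a h v → Tendsto a k w
    tendsto-cong e = tendsto-map (everywhere (λ z p → p , e z p))

    tendsto-const : ∀ {P} w → Tendsto {P} a (λ _ _ → w) w
    tendsto-const w ε 0<ε = everywhere λ _ _ → ∣∣<-cong (sym (-‿inverseʳ w)) (∣0∣< 0<ε)

    tendsto-id : ∀ {P} → Tendsto {P} a (λ z _ → z) a
    tendsto-id ε 0<ε = near-map (λ _ p _ → p) (near-disc a 0<ε)

    opaque
      tendsto-+ : ∀ {P} {h k : Family P} {v w} →
        Tendsto a h v → Tendsto a k w → Tendsto a (λ z p → h z p + k z p) (v + w)
      tendsto-+ {h = h} {k} {v} {w} p q = vanishes-map
        (everywhere λ z r → r , solve 4 (λ h k v w → (h :- v) :+ (k :- w) := (h :+ k) :- (v :+ w))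
          refl (h z r) (k z r) v w)
        (vanishes-+ p q)
        where open ℂ-Solver

    opaque
      tendsto⇒bounded : ∀ {P} {h : Family P} {w} → Tendsto a h w → Bounded a h
      tendsto⇒bounded {h = h} {w} p =
        let B , 0<B , b = bounded-+ (vanishes⇒bounded p) (bounded-const w) in
        B , 0<B , near-map (λ z lt r → ℝ.<-respˡ (∣∣²-cong
          (solve 2 (λ h w → (h :- w) :+ w := h) refl (h z r) w)) (lt r)) b
        where open ℂ-Solver

    opaque
      -- From `hk - vw = (h - v)k + (k - w)v`: each summand is a vanishing factor times a bounded
      -- one.
      tendsto-* : ∀ {P} {h k : Family P} {v w} →
        Tendsto a h v → Tendsto a k w → Tendsto a (λ z p → h z p * k z p) (v * w)
      tendsto-* {h = h} {k} {v} {w} p q = vanishes-map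
        (everywhere λ z r → r , solve 4 (λ h k v w → (h :- v) :* k :+ (k :- w) :* v := h :* k :- v :* w)
          refl (h z r) (k z r) v w)
        (vanishes-+ (vanishes-*-bounded p (tendsto⇒bounded q)) (vanishes-*-bounded q (bounded-const v)))
        where open ℂ-Solver

-- Equality of partial functions, and the rules of differentiation.

module DerivativeProperties (R : Reals) where

  open ComplexProperties R public
  open Equivalence
  open _≃_

  -- Since `≃` compares values at arbitrary domain proofs, this is exactly what `f ≃ f` requires.
  ProofIrrelevant : PartialFn → Set
  ProofIrrelevant f = ∀ z (p q : Dom f z) → val f z p ≈ val f z q

  ≃-refl : ∀ {f} → ProofIrrelevant f → f ≃ f
  ≃-refl irr = record { Dom-⇔ = λ z → mk⇔ id id ; val-≈ = irr }

  ≃-sym : ∀ {f g} → f ≃ g → g ≃ f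
  ≃-sym e = record
    { Dom-⇔ = λ z → mk⇔ (from (Dom-⇔ e z)) (to (Dom-⇔ e z))
    ; val-≈ = λ z p q → sym (val-≈ e z q p)
    }

  ≃-trans : ∀ {f g h} → f ≃ g → g ≃ h → f ≃ h
  ≃-trans e e′ = record
    { Dom-⇔ = λ z → mk⇔ (to (Dom-⇔ e′ z) ∘ to (Dom-⇔ e z)) (from (Dom-⇔ e z) ∘ from (Dom-⇔ e′ z))
    ; val-≈ = λ z p r → let q = to (Dom-⇔ e z) p in trans (val-≈ e z p q) (val-≈ e′ z q r)
    }

  ≃⇒irrelevantˡ : ∀ {f g} → f ≃ g → ProofIrrelevant f
  ≃⇒irrelevantˡ e z p q = let r = to (Dom-⇔ e z) p in trans (val-≈ e z p r) (sym (val-≈ e z q r))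

  ≃⇒irrelevantʳ : ∀ {f g} → f ≃ g → ProofIrrelevant g
  ≃⇒irrelevantʳ = ≃⇒irrelevantˡ ∘ ≃-sym

  ⊗-cong : ∀ {f f′ g g′} → f ≃ f′ → g ≃ g′ → (f ⊗ g) ≃ (f′ ⊗ g′)
  ⊗-cong e e′ = record
    { Dom-⇔ = λ z → mk⇔
        (λ (p , q) → to (Dom-⇔ e z) p , to (Dom-⇔ e′ z) q)
        (λ (p , q) → from (Dom-⇔ e z) p , from (Dom-⇔ e′ z) q)
    ; val-≈ = λ z (p , q) (p′ , q′) → *-cong (val-≈ e z p p′) (val-≈ e′ z q q′)
    }

  ⊕-cong : ∀ {f f′ g g′} → f ≃ f′ → g ≃ g′ → (f ⊕ g) ≃ (f′ ⊕ g′)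
  ⊕-cong e e′ = record
    { Dom-⇔ = λ z → mk⇔
        (λ (p , q) → to (Dom-⇔ e z) p , to (Dom-⇔ e′ z) q)
        (λ (p , q) → from (Dom-⇔ e z) p , from (Dom-⇔ e′ z) q)
    ; val-≈ = λ z (p , q) (p′ , q′) → +-cong (val-≈ e z p p′) (val-≈ e′ z q q′)
    }

  ⊗-irrelevant : ∀ {f g} → ProofIrrelevant f → ProofIrrelevant g → ProofIrrelevant (f ⊗ g)
  ⊗-irrelevant i j z (p , q) (p′ , q′) = *-cong (i z p p′) (j z q q′)

  ⊕-irrelevant : ∀ {f g} → ProofIrrelevant f → ProofIrrelevant g → ProofIrrelevant (f ⊕ g)
  ⊕-irrelevant i j z (p , q) (p′ , q′) = +-cong (i z p p′) (j z q q′)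

  const-irrelevant : ∀ c → ProofIrrelevant (const c)
  const-irrelevant c z p q = refl

  infixr 8 _^ᶠ_
  -- The domain stays that of `f` even for exponent zero, so that `reciprocal ^ᶠ m` is `1/z^ m`.
  _^ᶠ_ : PartialFn → ℕ → PartialFn
  f ^ᶠ m = record { Dom = Dom f ; val = λ z p → val f z p ^ m }

  ^-cong : ∀ m {x y} → x ≈ y → x ^ m ≈ y ^ m
  ^-cong zero    x≈y = refl
  ^-cong (suc m) x≈y = *-cong x≈y (^-cong m x≈y)

  ^ᶠ-irrelevant : ∀ {f} → ProofIrrelevant f → ∀ m → ProofIrrelevant (f ^ᶠ m)
  ^ᶠ-irrelevant i m z p q = ^-cong m (i z p q)

  identity : PartialFn
  identity = record { Dom = Dom (const 0#) ; val = λ z _ → z }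

  reciprocal : PartialFn
  reciprocal = record { Dom = NonZero ; val = inverse }

  reciprocal-irrelevant : ProofIrrelevant reciprocal
  reciprocal-irrelevant z p q = inverse-cong p q refl

  Punctured : PartialFn → ℂ → ℂ → Set
  Punctured f a z = Dom f z × NonZero (z - a)

  slope : ∀ f a → Dom f a → Family (Punctured f a)
  slope f a p z (q , z≠a) = (val f z q - val f a p) * inverse (z - a) z≠a

  -- With its converses `near-Dom` and `slope-tendsto`, this separates being defined near `a` from
  -- the limit of the slope, so that limit rules apply.
  hasDerivative : ∀ {f a w} (p : Dom f a) → Near a (Dom f) → Tendsto a (slope f a p) w →
    HasDerivative f a w
  hasDerivative p n t = p , λ ε 0<ε →
    let δ , 0<δ , r = near-× n (t ε 0<ε) in
    δ , 0<δ , λ z z<δ → proj₁ (r z z<δ) , λ q z≠a → proj₂ (r z z<δ) (q , z≠a)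

  near-Dom : ∀ {f a w} → HasDerivative f a w → Near a (Dom f)
  near-Dom (p , d) = let δ , 0<δ , r = d ℝ.1# ℝ.0<1 in δ , 0<δ , λ z z<δ → proj₁ (r z z<δ)

  slope-tendsto : ∀ {f a w} (d : HasDerivative f a w) → Tendsto a (slope f a (proj₁ d)) w
  slope-tendsto (p , d) ε 0<ε = let δ , 0<δ , r = d ε 0<ε in
    δ , 0<δ , λ z z<δ (q , z≠a) → proj₂ (r z z<δ) q z≠a

  -- Only the germ at `a` matters, and `g` need only extend `f` there: the limit for `f` already
  -- covers every nearby point of `g`, because `f` is defined near `a`.
  hasDerivative-local : ∀ {f g a w w′} →
    Near a (λ z → Dom f z → Dom g z × (∀ p q → val f z p ≈ val g z q)) → w ≈ w′ →
    HasDerivative f a w → HasDerivative g a w′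
  hasDerivative-local {f} {g} {a} e w≈w′ d@(p , _) =
    hasDerivative q (near-map (λ z (x , y) → proj₁ (x y)) near) (tendsto-map
      (near-map (λ z (x , y) (r , z≠a) → (y , z≠a) ,
        *-congʳ (+-cong (proj₂ (x y) y r) (-‿cong (proj₂ (near-at e p) p q)))) near)
      w≈w′ (slope-tendsto d))
    where
    near = near-× e (near-Dom d)
    q : Dom g a
    q = proj₁ (near-at e p)

  opaque
    -- The premise `meets` says that `a` is a limit point of `P`. At a nearby point of `P`, `v - w`
    -- is the difference of the two errors `h - w` and `h - v`, so it is arbitrarily small.
    tendsto-unique : ∀ {P : ℂ → Set} {a} {h : Family P} {v w} →
      (∀ {Q : ℂ → Set} → Near a Q → ∃[ z ] P z × Q z) →
      Tendsto a h v → Tendsto a h w → v ≈ w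
    tendsto-unique {h = h} {v} {w} meets s t = trans
      (solve 2 (λ v w → v := (v :- w) :+ w) refl v w)
      (trans (+-congʳ v-w≈0) (solve 1 (λ w → con ℤ.0ℤ :+ w := w) refl w))
      where
      open ℂ-Solver
      v-w≈0 : v - w ≈ 0#
      v-w≈0 = ∣∣<⇒≈0 λ ε 0<ε →
        let z , p , b = meets (vanishes-+ t (vanishes-*-bounded s (bounded-const (- 1#))) ε 0<ε) in
        ∣∣<-cong (solve 3 (λ h v w → (h :- w) :+ (h :- v) :* :- con ℤ.1ℤ := v :- w) refl (h z p) v w) (b p)

    derivative-unique : ∀ {f a w w′} → ProofIrrelevant f →
      HasDerivative f a w → HasDerivative f a w′ → w ≈ w′
    derivative-unique {f} {a} {w} {w′} irr d d′ = tendsto-unique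
      (λ n → let z , z≠a , p , q = near-punctured (near-× (near-Dom d) n) in z , (p , z≠a) , q)
      (tendsto-cong (λ z p → *-congʳ (+-congˡ (-‿cong (irr a _ _)))) refl (slope-tendsto d))
      (slope-tendsto d′)

    hasDerivative-const : ∀ c a → HasDerivative (const c) a 0#
    hasDerivative-const c a = hasDerivative _ (everywhere _) (tendsto-cong
      (λ z (_ , z≠a) → sym (trans (*-congʳ (-‿inverseʳ c)) (zeroˡ _))) refl (tendsto-const 0#))

    hasDerivative-identity : ∀ a → HasDerivative identity a 1#
    hasDerivative-identity a = hasDerivative _ (everywhere _) (tendsto-cong
      (λ z (_ , z≠a) → sym (trans (*-comm _ _) (inverseˡ (z - a) z≠a))) refl (tendsto-const 1#))

    hasDerivative-⊕ : ∀ {f g a v w} → HasDerivative f a v → HasDerivative g a w →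
      HasDerivative (f ⊕ g) a (v + w)
    hasDerivative-⊕ {f} {g} {a} d@(p , _) e@(q , _) =
      hasDerivative (p , q) (near-× (near-Dom d) (near-Dom e)) (tendsto-cong
        (λ z ((r , s) , z≠a) → solve 5
          (λ f f₀ g g₀ i → (f :- f₀) :* i :+ (g :- g₀) :* i := ((f :+ g) :- (f₀ :+ g₀)) :* i)
          refl (val f z r) (val f a p) (val g z s) (val g a q) _)
        refl
        (tendsto-+ {P = Punctured (f ⊕ g) a}
          (tendsto-map (everywhere λ z ((r , s) , z≠a) → (r , z≠a) , refl) refl (slope-tendsto d))
          (tendsto-map (everywhere λ z ((r , s) , z≠a) → (s , z≠a) , refl) refl (slope-tendsto e))))
      where open ℂ-Solver

    -- Off `a`, the value is `f(a)` plus the slope times `z - a`, and the last factor tends to zero.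
    continuous : ∀ {f a w} (d : HasDerivative f a w) →
      Tendsto {Punctured f a} a (λ z (p , _) → val f z p) (val f a (proj₁ d))
    continuous {f} {a} {w} d@(p , _) = tendsto-cong
      (λ z (q , z≠a) → trans (+-congˡ
          (trans (*-assoc _ _ _) (trans (*-congˡ (inverseˡ (z - a) z≠a)) (*-identityʳ _))))
        (solve 2 (λ f f₀ → f₀ :+ (f :- f₀) := f) refl (val f z q) (val f a p)))
      (solve 3 (λ f₀ w a → f₀ :+ w :* (a :- a) := f₀) refl (val f a p) w a)
      (tendsto-+ (tendsto-const (val f a p))
        (tendsto-* (slope-tendsto d) (tendsto-+ tendsto-id (tendsto-const (- a)))))
      where open ℂ-Solver

    -- The increment of the product is `f (g - g₀) + (f - f₀) g₀`, so continuity is called for in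
    -- the first factor only.
    hasDerivative-⊗ : ∀ {f g a v w} (d : HasDerivative f a v) (e : HasDerivative g a w) →
      HasDerivative (f ⊗ g) a (val f a (proj₁ d) * w + v * val g a (proj₁ e))
    hasDerivative-⊗ {f} {g} {a} d@(p , _) e@(q , _) =
      hasDerivative (p , q) (near-× (near-Dom d) (near-Dom e)) (tendsto-cong
        (λ z ((r , s) , z≠a) → solve 5
          (λ f f₀ g g₀ i → f :* ((g :- g₀) :* i) :+ (f :- f₀) :* i :* g₀ := (f :* g :- f₀ :* g₀) :* i)
          refl (val f z r) (val f a p) (val g z s) (val g a q) _)
        refl
        (tendsto-+ {P = Punctured (f ⊗ g) a}
          (tendsto-*
            (tendsto-map (everywhere λ z ((r , s) , z≠a) → (r , z≠a) , refl) refl (continuous d))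
            (tendsto-map (everywhere λ z ((r , s) , z≠a) → (s , z≠a) , refl) refl (slope-tendsto e)))
          (tendsto-*
            (tendsto-map (everywhere λ z ((r , s) , z≠a) → (r , z≠a) , refl) refl (slope-tendsto d))
            (tendsto-const _))))
      where open ℂ-Solver

    -- Here `q` is a quarter of `∣ a ∣²`. If `z` and `z - a` both had squared norm below `q`, then
    -- `∣+∣²<` would give `∣ a ∣² < 4q`, a contradiction. This only yields `q ≤ ∣ z ∣²`, so half of
    -- `q` is the strict bound.
    nonZero-near : ∀ {a} → NonZero a → ∃[ c ] (ℝ.0# ℝ.< c) × Near a (λ z → c ℝ.< ∣ z ∣²)
    nonZero-near {a} a≠0 = ℝ.half q , ℝ.half-pos 0<q ,
      δ , 0<δ , λ z z<δ → ℝ.<-≤-trans (ℝ.half-< 0<q) λ z²<q →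
        ℝ.<-irrefl ℝ.refl (ℝ.<-resp
          (∣∣²-cong (solve 2 (λ z a → :- (z :- a) :+ z := a) refl z a))
          (ℝ.trans (ℝ.+-cong (ℝ.half-double _) (ℝ.half-double _)) (ℝ.half-double _))
          (∣+∣²< (ℝ.<-respˡ (ℝ.sym (∣∣²-neg (z - a))) (ℝ.<-trans z<δ δ²<q)) z²<q))
      where
      open ℂ-Solver
      q : ℝ.Carrier
      q = ℝ.half (ℝ.half ∣ a ∣²)
      0<q : ℝ.0# ℝ.< q
      0<q = ℝ.half-pos (ℝ.half-pos a≠0)
      δ : ℝ.Carrier
      δ = proj₁ (ℝ.small-square 0<q)
      0<δ : ℝ.0# ℝ.< δ
      0<δ = proj₁ (proj₂ (ℝ.small-square 0<q))
      δ²<q : δ ℝ.* δ ℝ.< q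
      δ²<q = proj₂ (proj₂ (ℝ.small-square 0<q))

  opaque
    ∣inverse∣² : ∀ {z c} p (0<c : ℝ.0# ℝ.< c) → c ℝ.< ∣ z ∣² → ∣ inverse z p ∣² ℝ.< c ℝ.⁻¹⟨ 0<c ⟩
    ∣inverse∣² {z} {c} p 0<c c<∣z∣² = ℝ.<-resp
      (ℝ.trans (solve 3 (λ c n i → c :* n :* i := n :* (c :* i)) ℝ.refl c ∣ inverse z p ∣² _)
        (ℝ.trans (ℝ.*-congˡ (ℝ.*-⁻¹ c 0<c)) (ℝ.*-identityʳ _)))
      (ℝ.trans (ℝ.*-congʳ ∣z∣²∣i∣²≈1) (ℝ.*-identityˡ _))
      (ℝ.*-monoˡ-< (ℝ.⁻¹-pos 0<c) (ℝ.*-monoˡ-< 0<∣i∣² c<∣z∣²))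
      where
      open ℝ-Solver
      ∣z∣²∣i∣²≈1 : ∣ z ∣² ℝ.* ∣ inverse z p ∣² ℝ.≈ ℝ.1#
      ∣z∣²∣i∣²≈1 = ℝ.trans (ℝ.sym (∣∣²-* z (inverse z p)))
        (ℝ.trans (∣∣²-cong (trans (*-comm _ _) (inverseˡ z p)))
          (solve 0 (con ℤ.1ℤ :* con ℤ.1ℤ :+ con ℤ.0ℤ :* con ℤ.0ℤ := con ℤ.1ℤ) ℝ.refl))
      0<∣i∣² : ℝ.0# ℝ.< ∣ inverse z p ∣²
      0<∣i∣² = ℝ.*-cancel-pos (ℝ.<-trans 0<c c<∣z∣²) (ℝ.<-respʳ (ℝ.sym ∣z∣²∣i∣²≈1) ℝ.0<1)

  opaque
    -- The difference `1/z - 1/a` is `z - a` times `-1/(za)`, which is bounded because `z` stays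
    -- away from zero. The extra condition `P` lets the limit be taken over a punctured domain.
    inverse-tendsto : ∀ {P : ℂ → Set} {a} (a≠0 : NonZero a) →
      Tendsto {λ z → NonZero z × P z} a (λ z (z≠0 , _) → inverse z z≠0) (inverse a a≠0)
    inverse-tendsto {P} {a} a≠0 = vanishes-map
      (everywhere λ z p@(z≠0 , _) → p , trans
        (solve 4 (λ z a i j → (z :- a) :* (i :* :- j) := i :* (j :* a) :- j :* (i :* z))
          refl z a (inverse z z≠0) (inverse a a≠0))
        (+-cong (trans (*-congˡ (inverseˡ a a≠0)) (*-identityʳ _))
          (-‿cong (trans (*-congˡ (inverseˡ z z≠0)) (*-identityʳ _)))))
      (vanishes-*-bounded {k = λ z (z≠0 , _) → inverse z z≠0 * - inverse a a≠0} tendsto-id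
        (bounded-* bounded-inverse (bounded-const (- inverse a a≠0))))
      where
      open ℂ-Solver
      bounded-inverse : Bounded {λ z → NonZero z × P z} a (λ z (z≠0 , _) → inverse z z≠0)
      bounded-inverse = let c , 0<c , n = nonZero-near a≠0 in
        c ℝ.⁻¹⟨ 0<c ⟩ , ℝ.⁻¹-pos 0<c , near-map (λ z c<∣z∣² (z≠0 , _) → ∣inverse∣² z≠0 0<c c<∣z∣²) n

    hasDerivative-reciprocal : ∀ {a} (a≠0 : NonZero a) →
      HasDerivative reciprocal a (- (inverse a a≠0 * inverse a a≠0))
    hasDerivative-reciprocal {a} a≠0 = hasDerivative a≠0
      (let c , 0<c , n = nonZero-near a≠0 in near-map (λ z → ℝ.<-trans 0<c) n)
      (tendsto-cong
        (λ z (z≠0 , z≠a) → sym (inverse-slope (inverseˡ z z≠0) (inverseˡ a a≠0) (inverseˡ (z - a) z≠a)))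
        (solve 1 (λ i → :- con ℤ.1ℤ :* (i :* i) := :- (i :* i)) refl (inverse a a≠0))
        (tendsto-* (tendsto-const (- 1#)) (tendsto-* (inverse-tendsto a≠0) (tendsto-const (inverse a a≠0)))))
      where
      open ℂ-Solver
      inverse-slope : ∀ {z a i j k} → i * z ≈ 1# → j * a ≈ 1# → k * (z - a) ≈ 1# →
        (i - j) * k ≈ - 1# * (i * j)
      inverse-slope {z} {a} {i} {j} {k} iz ja k[z-a] = trans
        (*-congʳ (trans
          (+-cong (trans (sym (*-identityʳ i)) (*-congˡ (sym ja)))
            (-‿cong (trans (sym (*-identityʳ j)) (*-congˡ (sym iz)))))
          (solve 4 (λ z a i j → i :* (j :* a) :- j :* (i :* z) := :- (i :* j) :* (z :- a)) refl z a i j)))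
        (trans (solve 4 (λ z a i k → :- i :* (z :- a) :* k := :- con ℤ.1ℤ :* i :* (k :* (z :- a))) refl z a (i * j) k)
          (trans (*-congˡ k[z-a]) (*-identityʳ _)))

  -- This is `m v^(m-1) w`, in the shape that the product rule produces, without a predecessor of
  -- `m`.
  powerDerivative : ℂ → ℂ → ℕ → ℂ
  powerDerivative v w zero    = 0#
  powerDerivative v w (suc m) = v * powerDerivative v w m + w * v ^ m

  hasDerivative-^ᶠ : ∀ {f a w} → ProofIrrelevant f → (d : HasDerivative f a w) → ∀ m →
    HasDerivative (f ^ᶠ m) a (powerDerivative (val f a (proj₁ d)) w m)
  hasDerivative-^ᶠ {a = a} irr d zero = hasDerivative-local
    (near-map (λ z p _ → p , λ _ _ → refl) (near-Dom d)) refl (hasDerivative-const 1# a)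
  hasDerivative-^ᶠ {f} {a} {w} irr d (suc m) = hasDerivative-local
    (near-map (λ z p _ → p , λ (q , q′) r → *-cong (irr z q r) (^ᶠ-irrelevant {f} irr m z q′ r)) (near-Dom d))
    (+-congˡ (*-congˡ (^ᶠ-irrelevant {f} irr m a (proj₁ d^m) (proj₁ d))))
    (hasDerivative-⊗ d d^m)
    where
    d^m = hasDerivative-^ᶠ irr d m

  hasDerivative-1/z^ : ∀ {a} (a≠0 : NonZero a) m →
    HasDerivative (1/z^ m) a (- (fromℤ (ℤ.+ m) * inverse a a≠0 ^ suc m))
  hasDerivative-1/z^ {a} a≠0 m = hasDerivative-local
    (near-map (λ z z≠0 _ → z≠0 , ^ᶠ-irrelevant {reciprocal} reciprocal-irrelevant m z)
      (near-Dom (hasDerivative-reciprocal a≠0)))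
    (trans (powerDerivative-cong m) (powerDerivative-inverse m))
    (hasDerivative-^ᶠ reciprocal-irrelevant (hasDerivative-reciprocal a≠0) m)
    where
    open ℂ-Solver
    i = inverse a a≠0
    -- The derivative is opaque, so its domain proof does not reduce to `a≠0`; `inverse-cong`
    -- reconciles the two inverses.
    p = proj₁ (hasDerivative-reciprocal a≠0)
    powerDerivative-cong : ∀ m → powerDerivative (inverse a p) (- (i * i)) m ≈ powerDerivative i (- (i * i)) m
    powerDerivative-cong zero    = refl
    powerDerivative-cong (suc m) =
      +-cong (*-cong (inverse-cong p a≠0 refl) (powerDerivative-cong m))
        (*-congˡ (^-cong m (inverse-cong p a≠0 refl)))
    powerDerivative-inverse : ∀ m → powerDerivative i (- (i * i)) m ≈ - (fromℤ (ℤ.+ m) * i ^ suc m)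
    powerDerivative-inverse zero    = solve 1 (λ j → con ℤ.0ℤ := :- (con ℤ.0ℤ :* j)) refl (i ^ 1)
    powerDerivative-inverse (suc m) = trans (+-congʳ (*-congˡ (powerDerivative-inverse m)))
      (solve 3 (λ i n j → i :* :- (n :* (i :* j)) :+ :- (i :* i) :* j :=
        :- ((con ℤ.1ℤ :+ n) :* (i :* (i :* j)))) refl i (fromℤ (ℤ.+ m)) (i ^ m))

  D-cong : ∀ {f g} → f ≃ g → D f ≃ D g
  D-cong {f} {g} e = record
    { Dom-⇔ = λ z → mk⇔ (map₂ (transfer e)) (map₂ (transfer (≃-sym e)))
    ; val-≈ = λ z (w , d) (w′ , d′) → derivative-unique (≃⇒irrelevantʳ e) (transfer e d) d′
    }
    where
    transfer : ∀ {f g a w} → f ≃ g → HasDerivative f a w → HasDerivative g a w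
    transfer e = hasDerivative-local (everywhere λ z p → to (Dom-⇔ e z) p , val-≈ e z) refl

  -- Irrelevance of `f` is `f ≃ f`; `D-cong` turns this into `D f ≃ D f`, which is irrelevance of
  -- `D f`.
  D-irrelevant : ∀ {f} → ProofIrrelevant f → ProofIrrelevant (D f)
  D-irrelevant = ≃⇒irrelevantˡ ∘ D-cong ∘ ≃-refl

-- The coefficients: closed form, diagonal and recurrence.

module CoefficientProperties where

  open import Data.Integer.Base as ℤ using (+_; -1ℤ; 0ℤ; 1ℤ)
  import Data.Integer.Solver
  open import Data.Nat.Base
  open import Data.Nat.Combinatorics using (_C_; nCn≡1; nC1≡n; nCk≡nC[n∸k]; k>n⇒nCk≡0; nCk+nC[k+1]≡[n+1]C[k+1])
  open import Data.Nat.Properties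
  import Data.Nat.Solver
  open import Algebra.Properties.CommutativeSemigroup *-commutativeSemigroup using (x∙yz≈y∙xz)
  open import Relation.Binary.PropositionalEquality

  nC0≡1 : ∀ n → n C 0 ≡ 1
  nC0≡1 n = trans (nCk≡nC[n∸k] {0} {n} z≤n) (nCn≡1 n)

  -- The absorption identity, by induction on `n`: Pascal's rule splits the left side, the
  -- hypothesis applies to both parts, and Pascal's rule joins them again.
  [1+k]*[1+n]C[1+k]≡[1+n]*nCk : ∀ n k → suc k * (suc n C suc k) ≡ suc n * (n C k)
  [1+k]*[1+n]C[1+k]≡[1+n]*nCk n zero = begin
    1 * (suc n C 1)    ≡⟨ *-identityˡ _ ⟩
    suc n C 1          ≡⟨ nC1≡n (suc n) ⟩
    suc n              ≡⟨ *-identityʳ _ ⟨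
    suc n * 1          ≡⟨ cong (suc n *_) (nC0≡1 n) ⟨
    suc n * (n C 0)    ∎
    where open ≡-Reasoning
  [1+k]*[1+n]C[1+k]≡[1+n]*nCk zero (suc k) = begin
    suc (suc k) * (1 C suc (suc k))  ≡⟨ cong (suc (suc k) *_) (k>n⇒nCk≡0 {1} {suc (suc k)} (s≤s (s≤s z≤n))) ⟩
    suc (suc k) * 0                  ≡⟨ *-zeroʳ (suc (suc k)) ⟩
    0                                ≡⟨ cong (1 *_) (k>n⇒nCk≡0 {0} {suc k} (s≤s z≤n)) ⟨
    1 * (0 C suc k)                  ∎
    where open ≡-Reasoning
  [1+k]*[1+n]C[1+k]≡[1+n]*nCk (suc n) (suc k) = begin
    (2 + k) * ((2 + n) C (2 + k))
      ≡⟨ cong ((2 + k) *_) (nCk+nC[k+1]≡[n+1]C[k+1] (suc n) (suc k)) ⟨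
    (2 + k) * (suc n C suc k + suc n C (2 + k))
      ≡⟨ solve 3 (λ k a b → (con 2 :+ k) :* (a :+ b) := a :+ ((con 1 :+ k) :* a :+ (con 2 :+ k) :* b)) refl
           k (suc n C suc k) (suc n C (2 + k)) ⟩
    suc n C suc k + (suc k * (suc n C suc k) + (2 + k) * (suc n C (2 + k)))
      ≡⟨ cong (λ b → suc n C suc k + b) (cong₂ _+_ ([1+k]*[1+n]C[1+k]≡[1+n]*nCk n k)
           ([1+k]*[1+n]C[1+k]≡[1+n]*nCk n (suc k))) ⟩
    suc n C suc k + (suc n * (n C k) + suc n * (n C suc k))
      ≡⟨ cong (λ b → suc n C suc k + b) (*-distribˡ-+ (suc n) (n C k) (n C suc k)) ⟨
    suc n C suc k + suc n * (n C k + n C suc k)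
      ≡⟨ cong (λ b → suc n C suc k + suc n * b) (nCk+nC[k+1]≡[n+1]C[k+1] n k) ⟩
    (2 + n) * (suc n C suc k) ∎
    where
    open ≡-Reasoning
    open Data.Nat.Solver.+-*-Solver

  -- Absorption read at the complementary lower index.
  [1+m]*[1+m+j]Cj≡[1+m+j]*[m+j]Cj : ∀ m j → suc m * (suc (m + j) C j) ≡ suc (m + j) * ((m + j) C j)
  [1+m]*[1+m+j]Cj≡[1+m+j]*[m+j]Cj m j = begin
    suc m * (suc (m + j) C j)      ≡⟨ cong (suc m *_) (sym-C (suc m) j) ⟩
    suc m * (suc (m + j) C suc m)  ≡⟨ [1+k]*[1+n]C[1+k]≡[1+n]*nCk (m + j) m ⟩
    suc (m + j) * ((m + j) C m)    ≡⟨ cong (suc (m + j) *_) (sym-C m j) ⟨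
    suc (m + j) * ((m + j) C j)    ∎
    where
    open ≡-Reasoning
    sym-C : ∀ m j → (m + j) C j ≡ (m + j) C m
    sym-C m j = trans (nCk≡nC[n∸k] (m≤n+m j m)) (cong ((m + j) C_) (m+n∸n≡m m j))

  -- The number `(2n-1)!!`, recursive in `n` and free of integer subtraction.
  oddFactorial : ℕ → ℕ
  oddFactorial zero    = 1
  oddFactorial (suc n) = suc (2 * n) * oddFactorial n

  doubleFactorial-odd : ∀ n → doubleFactorial (+ (2 * n) ℤ.- 1ℤ) ≡ oddFactorial n
  doubleFactorial-odd zero    = refl
  doubleFactorial-odd (suc n) = trans
    (cong doubleFactorial (trans (ℤ.⊖-≥ {2 * suc n} {1} (s≤s z≤n)) (cong +_ (+-suc n (n + 0))))) (go n)
    where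
    go : ∀ n → doubleFactorial (+ suc (2 * n)) ≡ oddFactorial (suc n)
    go zero    = refl
    go (suc n) rewrite +-suc n (n + 0) = cong (λ b → suc (suc (suc (n + (n + 0)))) * b) (go n)

  coefficient-zero : ∀ k → coefficient k 0 ≡ 0ℤ
  coefficient-zero k = ℤ.*-zeroʳ (-1ℤ ℤ.^ k ℤ.* + doubleFactorial (+ (2 * k) ℤ.- + 0 ℤ.- 1ℤ))

  2[n+1+j]≡ : ∀ n j → 2 * (n + suc j) ≡ suc (2 * n + j) + suc j
  2[n+1+j]≡ = solve 2 (λ n j →
    con 2 :* (n :+ (con 1 :+ j)) := con 1 :+ (con 2 :* n :+ j) :+ (con 1 :+ j)) refl
    where open Data.Nat.Solver.+-*-Solver

  -- Writing the power as `n + suc j` turns every truncated or integer subtraction into a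
  -- cancellation.
  coefficient-suc : ∀ n j →
    coefficient (n + suc j) (suc j) ≡ -1ℤ ℤ.^ n ℤ.* + oddFactorial n ℤ.* + ((2 * n + j) C j)
  coefficient-suc n j = cong₂ ℤ._*_
    (cong₂ ℤ._*_
      (cong (-1ℤ ℤ.^_) (m+n∸n≡m n (suc j)))
      (cong +_ (trans (cong (λ i → doubleFactorial (i ℤ.- 1ℤ)) difference) (doubleFactorial-odd n))))
    (cong (λ m → + (m C j)) lowered)
    where
    difference : + (2 * (n + suc j)) ℤ.- + (2 * suc j) ≡ + (2 * n)
    difference = trans (cong (λ m → + m ℤ.- + (2 * suc j)) (*-distribˡ-+ 2 n (suc j)))
      (trans (ℤ.[+m]-[+n]≡m⊖n (2 * n + 2 * suc j) (2 * suc j))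
        (trans (ℤ.⊖-≥ (m≤n+m (2 * suc j) (2 * n))) (cong +_ (m+n∸n≡m (2 * n) (2 * suc j)))))
    lowered : 2 * (n + suc j) ∸ suc j ∸ 1 ≡ 2 * n + j
    lowered = trans (cong (λ m → m ∸ suc j ∸ 1) (2[n+1+j]≡ n j))
      (cong (_∸ 1) (m+n∸n≡m (suc (2 * n + j)) (suc j)))

  coefficient-diagonal : ∀ k → coefficient (suc k) (suc k) ≡ 1ℤ
  coefficient-diagonal k = trans (coefficient-suc 0 k) (cong (λ m → 1ℤ ℤ.* + m) (nCn≡1 k))

  -- With `n` for `k - s - 1`, the coefficients take the form of `coefficient-suc`, apart from
  -- `coefficient k 0`, which vanishes. Up to signs, what remains is `pascalℕ`.
  coefficient-recurrence′ : ∀ n s → let k = n + suc s in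
    coefficient (suc k) (suc s) ≡
      coefficient k s ℤ.- + (2 * k ∸ suc s) ℤ.* coefficient k (suc s)
  coefficient-recurrence′ n s = begin
    coefficient (suc n + suc s) (suc s)
      ≡⟨ coefficient-suc (suc n) s ⟩
    -1ℤ ℤ.^ suc n ℤ.* + F′ ℤ.* + ((2 * suc n + s) C s)
      ≡⟨ ℤ.*-assoc (-1ℤ ℤ.^ suc n) _ _ ⟩
    -1ℤ ℤ.^ suc n ℤ.* (+ F′ ℤ.* + ((2 * suc n + s) C s))
      ≡⟨ cong (-1ℤ ℤ.^ suc n ℤ.*_) pascal ⟩
    -1ℤ ℤ.* e ℤ.* (+ F′ ℤ.* + lower s ℤ.+ + suc (2 * n + s) ℤ.* (+ F ℤ.* + c))
      ≡⟨ solve 6 (λ e f′ l m f c → con -1ℤ :* e :* (f′ :* l :+ m :* (f :* c)) :=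
           con -1ℤ :* e :* f′ :* l :- m :* (e :* f :* c)) refl
           e (+ F′) (+ lower s) (+ suc (2 * n + s)) (+ F) (+ c) ⟩
    -1ℤ ℤ.* e ℤ.* + F′ ℤ.* + lower s ℤ.- + suc (2 * n + s) ℤ.* (e ℤ.* + F ℤ.* + c)
      ≡⟨ cong₂ ℤ._-_ (coefficient-lower s)
           (cong₂ (λ m → + m ℤ.*_) exponent (coefficient-suc n s)) ⟨
    coefficient (n + suc s) s ℤ.- + (2 * (n + suc s) ∸ suc s) ℤ.* coefficient (n + suc s) (suc s) ∎
    where
    open ≡-Reasoning
    open Data.Integer.Solver.+-*-Solver
    e  = -1ℤ ℤ.^ n
    F  = oddFactorial n
    F′ = oddFactorial (suc n)
    c  = (2 * n + s) C s

    -- This is `C(2n+1+s, s-1)`, set to `0` at `s = 0` in line with the convention for the lower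
    -- index `-1`, so that Pascal's rule `split` covers that case too.
    lower : ℕ → ℕ
    lower zero    = 0
    lower (suc i) = (2 * suc n + i) C i

    coefficient-lower : ∀ s → coefficient (n + suc s) s ≡ -1ℤ ℤ.^ suc n ℤ.* + F′ ℤ.* + lower s
    coefficient-lower zero    = trans (coefficient-zero (n + 1)) (sym (ℤ.*-zeroʳ (-1ℤ ℤ.^ suc n ℤ.* + F′)))
    coefficient-lower (suc i) = trans (cong (λ k → coefficient k (suc i)) (+-suc n (suc i)))
      (coefficient-suc (suc n) i)

    exponent : 2 * (n + suc s) ∸ suc s ≡ suc (2 * n + s)
    exponent = trans (cong (_∸ suc s) (2[n+1+j]≡ n s)) (m+n∸n≡m (suc (2 * n + s)) (suc s))

    shift : ∀ s → 2 * suc n + s ≡ suc (suc (2 * n + s))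
    shift s = cong (λ m → suc (m + s)) (+-suc n (n + 0))

    split : ∀ s → (2 * suc n + s) C s ≡ lower s + (suc (2 * n + s) C s)
    split zero    = trans (nC0≡1 (2 * suc n + 0)) (sym (nC0≡1 (suc (2 * n + 0))))
    split (suc i) = trans (cong (_C (suc i)) (+-suc (2 * suc n) i))
      (trans (sym (nCk+nC[k+1]≡[n+1]C[k+1] (2 * suc n + i) i))
        (cong (λ m → lower (suc i) + m C suc i) (trans (shift i) (cong suc (sym (+-suc (2 * n) i))))))

    pascalℕ : F′ * ((2 * suc n + s) C s) ≡ F′ * lower s + suc (2 * n + s) * (F * c)
    pascalℕ = begin
      F′ * ((2 * suc n + s) C s)                          ≡⟨ cong (F′ *_) (split s) ⟩
      F′ * (lower s + suc (2 * n + s) C s)                ≡⟨ *-distribˡ-+ F′ _ _ ⟩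
      F′ * lower s + suc (2 * n) * F * (suc (2 * n + s) C s)
        ≡⟨ cong (λ b → F′ * lower s + b)
             (trans (cong (_* (suc (2 * n + s) C s)) (*-comm (suc (2 * n)) F)) (*-assoc F (suc (2 * n)) _)) ⟩
      F′ * lower s + F * (suc (2 * n) * (suc (2 * n + s) C s))
        ≡⟨ cong (λ m → F′ * lower s + F * m) ([1+m]*[1+m+j]Cj≡[1+m+j]*[m+j]Cj (2 * n) s) ⟩
      F′ * lower s + F * (suc (2 * n + s) * c)
        ≡⟨ cong (λ b → F′ * lower s + b) (x∙yz≈y∙xz F (suc (2 * n + s)) c) ⟩
      F′ * lower s + suc (2 * n + s) * (F * c)            ∎

    pascal : + F′ ℤ.* + ((2 * suc n + s) C s) ≡ + F′ ℤ.* + lower s ℤ.+ + suc (2 * n + s) ℤ.* (+ F ℤ.* + c)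
    pascal = trans (sym (ℤ.pos-* F′ _)) (trans (cong +_ pascalℕ)
      (trans (ℤ.pos-+ (F′ * lower s) _)
        (cong₂ ℤ._+_ (ℤ.pos-* F′ (lower s))
          (trans (ℤ.pos-* (suc (2 * n + s)) (F * c)) (cong (+ suc (2 * n + s) ℤ.*_) (ℤ.pos-* F c))))))

  coefficient-recurrence : ∀ {k s} → suc s ≤ k →
    coefficient (suc k) (suc s) ≡
      coefficient k s ℤ.- + (2 * k ∸ suc s) ℤ.* coefficient k (suc s)
  coefficient-recurrence {k} {s} s<k = subst
    (λ k → coefficient (suc k) (suc s) ≡ coefficient k s ℤ.- + (2 * k ∸ suc s) ℤ.* coefficient k (suc s))
    (m∸n+n≡m s<k) (coefficient-recurrence′ (k ∸ suc s) s)

-- The telescoping identity, sums of operators and the induction.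

module PowersOfA₃ (R : Reals) where

  open CoefficientProperties
  open import Data.Nat.Base using (_∸_; _≤_; _<_)
  open DerivativeProperties R public
  module ℤ→ℂ = IntegerEmbedding ℂ-commutativeRing
  open ℂ-Solver using (solve; _:+_; _:*_; _:-_; :-_; _:=_; con)
  open Equivalence
  open _≃_
  open SetoidReasoning setoid

  Σ< : ℕ → (ℕ → ℂ) → ℂ
  Σ< zero    t = 0#
  Σ< (suc n) t = Σ< n t + t n

  γ : ℕ → ℕ → ℂ
  γ k s = fromℤ (coefficient k s)

  fromℤ≡ : ∀ i → fromℤ i ≡ ℤ→ℂ.fromℤ i
  fromℤ≡ (+ n)    = ≡.refl
  fromℤ≡ -[1+ n ] = ≡.refl

  opaque
    fromℤ-linear : ∀ i m j → fromℤ (i ℤ.- m ℤ.* j) ≈ fromℤ i - fromℤ m * fromℤ j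
    fromℤ-linear i m j = begin
      fromℤ (i ℤ.- m ℤ.* j)
        ≡⟨ fromℤ≡ (i ℤ.- m ℤ.* j) ⟩
      ℤ→ℂ.fromℤ (i ℤ.- m ℤ.* j)
        ≈⟨ ℤ→ℂ.fromℤ-+ i (ℤ.- (m ℤ.* j)) ⟩
      ℤ→ℂ.fromℤ i + ℤ→ℂ.fromℤ (ℤ.- (m ℤ.* j))
        ≈⟨ +-congˡ (trans (ℤ→ℂ.fromℤ-neg (m ℤ.* j)) (-‿cong (ℤ→ℂ.fromℤ-* m j))) ⟩
      ℤ→ℂ.fromℤ i - ℤ→ℂ.fromℤ m * ℤ→ℂ.fromℤ j
        ≡⟨ ≡.cong₂ _-_ (fromℤ≡ i) (≡.cong₂ _*_ (fromℤ≡ m) (fromℤ≡ j)) ⟨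
      fromℤ i - fromℤ m * fromℤ j ∎

  opaque
    γ-zero : ∀ k → γ k 0 ≈ 0#
    γ-zero k = reflexive (≡.cong fromℤ (coefficient-zero k))

    γ-diagonal : ∀ k → γ (suc k) (suc k) ≈ 1#
    γ-diagonal k = trans (reflexive (≡.cong fromℤ (coefficient-diagonal k))) (+-identityʳ 1#)

    γ-recurrence : ∀ {k s} → suc s ≤ k →
      γ (suc k) (suc s) ≈ γ k s - fromℤ (+ (2 ℕ.* k ∸ suc s)) * γ k (suc s)
    γ-recurrence {k} {s} s<k = trans
      (reflexive (≡.cong fromℤ (coefficient-recurrence s<k)))
      (fromℤ-linear (coefficient k s) (+ (2 ℕ.* k ∸ suc s)) (coefficient k (suc s)))

  2k∸n : ∀ {k n} → suc n ≤ k → 2 ℕ.* k ∸ n ≡ suc (2 ℕ.* k ∸ suc n)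
  2k∸n {k} {n} n<k = ℕ.+-∸-assoc 1 (ℕ.≤-trans n<k (ℕ.m≤m+n k _))

  2[1+k]∸[1+n] : ∀ {k n} → n ≤ k → 2 ℕ.* suc k ∸ suc n ≡ suc (2 ℕ.* k ∸ n)
  2[1+k]∸[1+n] {k} {n} n≤k = ≡.trans (≡.cong (_∸ n) (ℕ.+-suc k (k ℕ.+ 0)))
    (ℕ.+-∸-assoc 1 (ℕ.≤-trans n≤k (ℕ.m≤m+n k _)))

  module _ (x : ℂ) (d : ℕ → ℂ) where

    summand : ℕ → ℕ → ℂ
    summand k s = γ k s * (x ^ (2 ℕ.* k ∸ s) * d s)

    -- The derivative of summand k s, when x = 1/z and d s is the s-th
    -- derivative of f.
    summand′ : ℕ → ℕ → ℂ
    summand′ k s = let m = 2 ℕ.* k ∸ s in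
      γ k s * (x ^ m * d (suc s) + - (fromℤ (+ m) * x ^ suc m) * d s)

    opaque
      -- The remainder is the part of the last summand in which `d` was differentiated. In the next
      -- summand, the part from differentiating the power of `x` has the same power and the same
      -- `d`, and `γ-recurrence` merges the two coefficients.
      telescope : ∀ {k} n → n ≤ k →
        x * Σ< (suc n) (summand′ k) ≈
          Σ< (suc n) (summand (suc k)) + γ k n * (x ^ suc (2 ℕ.* k ∸ n) * d (suc n))
      telescope {k} zero _ = begin
        x * (0# + γ k 0 * v)
          ≈⟨ *-congˡ (+-congˡ (*-congʳ (γ-zero k))) ⟩
        x * (0# + 0# * v)
          ≈⟨ solve 4 (λ x v u w → x :* (con ℤ.0ℤ :+ con ℤ.0ℤ :* v) :=
               (con ℤ.0ℤ :+ con ℤ.0ℤ :* u) :+ con ℤ.0ℤ :* w) refl x v u w ⟩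
        (0# + 0# * u) + 0# * w
          ≈⟨ +-cong (+-congˡ (*-congʳ (γ-zero (suc k)))) (*-congʳ (γ-zero k)) ⟨
        (0# + γ (suc k) 0 * u) + γ k 0 * w ∎
        where
        v u w : ℂ
        v = x ^ (2 ℕ.* k) * d 1 + - (fromℤ (+ (2 ℕ.* k)) * x ^ suc (2 ℕ.* k)) * d 0
        u = x ^ (2 ℕ.* suc k) * d 0
        w = x ^ suc (2 ℕ.* k) * d 1
      telescope {k} (suc n) n<k = begin
        x * (Σ< (suc n) (summand′ k) + summand′ k (suc n))
          ≈⟨ solve 3 (λ x s t → x :* (s :+ t) := x :* s :+ x :* t) refl
               x (Σ< (suc n) (summand′ k)) (summand′ k (suc n)) ⟩
        x * Σ< (suc n) (summand′ k) + x * summand′ k (suc n)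
          ≈⟨ +-congʳ (telescope n (ℕ.<⇒≤ n<k)) ⟩
        (S + γ k n * (x ^ suc (2 ℕ.* k ∸ n) * d (suc n))) + x * summand′ k (suc n)
          ≡⟨ ≡.cong (λ e → (S + γ k n * (x ^ suc e * d (suc n))) + x * summand′ k (suc n)) (2k∸n n<k) ⟩
        (S + γ k n * (x ^ suc (suc m) * d (suc n))) + x * summand′ k (suc n)
          ≈⟨ solve 8 (λ S g g⁺ m x X d d⁺ →
               (S :+ g :* (x :* (x :* X) :* d)) :+ x :* (g⁺ :* (X :* d⁺ :+ :- (m :* (x :* X)) :* d)) :=
               (S :+ (g :- m :* g⁺) :* (x :* (x :* X) :* d)) :+ g⁺ :* (x :* X :* d⁺)) refl
               S (γ k n) (γ k (suc n)) (fromℤ (+ m)) x (x ^ m) (d (suc n)) (d (suc (suc n))) ⟩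
        (S + (γ k n - fromℤ (+ m) * γ k (suc n)) * (x ^ suc (suc m) * d (suc n))) + next
          ≈⟨ +-congʳ (+-congˡ (*-congʳ (γ-recurrence n<k))) ⟨
        (S + γ (suc k) (suc n) * (x ^ suc (suc m) * d (suc n))) + next
          ≡⟨ ≡.cong (λ e → (S + γ (suc k) (suc n) * (x ^ e * d (suc n))) + next)
               (≡.trans (2[1+k]∸[1+n] (ℕ.<⇒≤ n<k)) (≡.cong suc (2k∸n n<k))) ⟨
        Σ< (suc (suc n)) (summand (suc k)) + next ∎
        where
        m : ℕ
        m = 2 ℕ.* k ∸ suc n
        S next : ℂ
        S = Σ< (suc n) (summand (suc k))
        next = γ k (suc n) * (x ^ suc m * d (suc (suc n)))

    opaque
      -- After the full sum the remainder is the top summand for the next power, as both diagonal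
      -- coefficients are `1`.
      Σ-summand-suc : ∀ k → x * Σ< (2 ℕ.+ k) (summand′ (suc k)) ≈ Σ< (3 ℕ.+ k) (summand (2 ℕ.+ k))
      Σ-summand-suc k = trans (telescope (suc k) ℕ.≤-refl) (+-congˡ (*-cong
        (trans (γ-diagonal k) (sym (γ-diagonal (suc k))))
        (reflexive (≡.cong (λ e → x ^ e * d (2 ℕ.+ k)) (≡.sym (2[1+k]∸[1+n] {suc k} ℕ.≤-refl))))))

  -- Sums of operators split off the first term; telescoping and solving for the top derivative need
  -- the last one split off.
  partialSum : ℕ → (ℕ → PartialFn) → PartialFn
  partialSum zero    t = const 0#
  partialSum (suc n) t = partialSum n t ⊕ t n

  ∑[_] : ℕ → (ℕ → Operator) → Operator
  ∑[ n ] T = RawMonoidDefinitions.sum +ₒ-rawMonoid {n = n} (T ∘ toℕ)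

  ∑-irrelevant : ∀ {f} n T → (∀ s → ProofIrrelevant (T s f)) → ProofIrrelevant (∑[ n ] T f)
  ∑-irrelevant zero    T irr = const-irrelevant 0#
  ∑-irrelevant {f} (suc n) T irr =
    ⊕-irrelevant {T 0 f} (irr 0) (∑-irrelevant n (T ∘ suc) (irr ∘ suc))

  ∑-last : ∀ {f} n T → (∀ s → ProofIrrelevant (T s f)) → ∑[ suc n ] T f ≃ (∑[ n ] T f ⊕ T n f)
  ∑-last zero T irr = record
    { Dom-⇔ = λ z → mk⇔ (λ (p , q) → q , p) (λ (p , q) → q , p)
    ; val-≈ = λ z (p , _) (_ , q) → trans (+-comm _ _) (+-congˡ (irr 0 z p q))
    }
  ∑-last {f} (suc n) T irr = ≃-trans
    (⊕-cong (≃-refl {T 0 f} (irr 0)) (∑-last n (T ∘ suc) (irr ∘ suc)))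
    (record
      { Dom-⇔ = λ z → mk⇔ (λ (p , q , r) → (p , q) , r) (λ ((p , q) , r) → p , q , r)
      ; val-≈ = λ z (p , q , r) ((p′ , q′) , r′) → trans (sym (+-assoc _ _ _))
          (+-cong (+-cong (irr 0 z p p′) (∑-irrelevant n (T ∘ suc) (irr ∘ suc) z q q′)) (irr (suc n) z r r′))
      })

  ∑≃partialSum : ∀ {f} n T → (∀ s → ProofIrrelevant (T s f)) →
    ∑[ n ] T f ≃ partialSum n (λ s → T s f)
  ∑≃partialSum zero    T irr = ≃-refl {const 0#} (const-irrelevant 0#)
  ∑≃partialSum {f} (suc n) T irr =
    ≃-trans (∑-last n T irr) (⊕-cong (∑≃partialSum n T irr) (≃-refl {T n f} (irr n)))

  opaque
    x^m*y^m≈1 : ∀ {x y} m → x * y ≈ 1# → x ^ m * y ^ m ≈ 1#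
    x^m*y^m≈1 zero    xy≈1 = *-identityˡ 1#
    x^m*y^m≈1 {x} {y} (suc m) xy≈1 = begin
      (x * x ^ m) * (y * y ^ m)
        ≈⟨ solve 4 (λ x y X Y → (x :* X) :* (y :* Y) := (x :* y) :* (X :* Y)) refl x y (x ^ m) (y ^ m) ⟩
      (x * y) * (x ^ m * y ^ m)  ≈⟨ *-cong xy≈1 (x^m*y^m≈1 m xy≈1) ⟩
      1# * 1#                    ≈⟨ *-identityˡ 1# ⟩
      1#                         ∎

  hasDerivative-≈ : ∀ {f a w w′} → w ≈ w′ → HasDerivative f a w → HasDerivative f a w′
  hasDerivative-≈ w≈w′ d = hasDerivative (proj₁ d) (near-Dom d)
    (tendsto-cong (λ _ _ → refl) w≈w′ (slope-tendsto d))

  termₒ : ℕ → ℕ → Operator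
  termₒ k s = multiplyBy (const (γ k s)) ∘ multiplyBy (1/z^ (2 ℕ.* k ∸ s)) ∘ (D ^∘ s)

  module _ (f : PartialFn) (f-irrelevant : ProofIrrelevant f) where

    term : ℕ → ℕ → PartialFn
    term k s = termₒ k s f

    D^-irrelevant : ∀ s → ProofIrrelevant ((D ^∘ s) f)
    D^-irrelevant zero    = f-irrelevant
    D^-irrelevant (suc s) = D-irrelevant (D^-irrelevant s)

    1/z^-irrelevant : ∀ m → ProofIrrelevant (1/z^ m)
    1/z^-irrelevant m = ^ᶠ-irrelevant {reciprocal} reciprocal-irrelevant m

    term-irrelevant : ∀ k s → ProofIrrelevant (term k s)
    term-irrelevant k s = ⊗-irrelevant {const (γ k s)} (const-irrelevant (γ k s))
      (⊗-irrelevant {1/z^ (2 ℕ.* k ∸ s)} (1/z^-irrelevant (2 ℕ.* k ∸ s)) (D^-irrelevant s))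

    S : ℕ → ℕ → PartialFn
    S k n = partialSum n (term k)

    S-irrelevant : ∀ k n → ProofIrrelevant (S k n)
    S-irrelevant k zero    = const-irrelevant 0#
    S-irrelevant k (suc n) = ⊕-irrelevant {S k n} (S-irrelevant k n) (term-irrelevant k n)

    -- Domains are intersected whatever the coefficients are, so even the term with coefficient zero
    -- records that `f` is defined at `a`.
    S-D^ : ∀ {k n a} → Dom (S k n) a → ∀ s → s < n → Dom ((D ^∘ s) f) a
    S-D^ {n = suc n} (p , (_ , _ , q)) s (s≤s s≤n) with s ℕ.≟ n
    ... | yes ≡.refl = q
    ... | no s≢n     = S-D^ p s (ℕ.≤∧≢⇒< s≤n s≢n)

    module _ {a} (a≠0 : NonZero a) (K : ℕ) (D^-defined : ∀ s → s ≤ K → Dom ((D ^∘ s) f) a) where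

      -- The values of the derivatives at `a` up to order `K`, freed from domain proofs and made
      -- total by a default, so that the ring identities on sequences apply.
      jet : ℕ → ℂ
      jet s with s ℕ.≤? K
      ... | yes s≤K = val ((D ^∘ s) f) a (D^-defined s s≤K)
      ... | no  _   = 0#

      jet-val : ∀ {s} → s ≤ K → ∀ p → val ((D ^∘ s) f) a p ≈ jet s
      jet-val {s} s≤K p with s ℕ.≤? K
      ... | yes s≤K = D^-irrelevant s a p _
      ... | no  s≰K = contradiction s≤K s≰K

      hasDerivative-D^ : ∀ {s} → s < K → HasDerivative ((D ^∘ s) f) a (jet (suc s))
      hasDerivative-D^ {s} s<K = let w , d = D^-defined (suc s) s<K in
        hasDerivative-≈ (jet-val s<K (w , d)) d

      S-Dom : ∀ k n → n ≤ suc K → Dom (S k n) a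
      S-Dom k zero    _         = tt
      S-Dom k (suc n) (s≤s n≤K) = S-Dom k n (ℕ.m≤n⇒m≤1+n n≤K) , tt , a≠0 , D^-defined n n≤K

      S-val : ∀ k n → n ≤ suc K → ∀ p → val (S k n) a p ≈ Σ< n (summand (inverse a a≠0) jet k)
      S-val k zero    _         p                  = refl
      S-val k (suc n) (s≤s n≤K) (p , _ , a≠0′ , q) =
        +-cong (S-val k n (ℕ.m≤n⇒m≤1+n n≤K) p)
          (*-congˡ (*-cong (1/z^-irrelevant (2 ℕ.* k ∸ n) a a≠0′ a≠0) (jet-val n≤K q)))

      opaque
        -- The last term has order `n - 1`, and differentiating it calls for order `n`; hence
        -- `n ≤ K`, where `S-Dom` gets by with `n ≤ suc K`.
        hasDerivative-S : ∀ k n → n ≤ K →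
          HasDerivative (S k n) a (Σ< n (summand′ (inverse a a≠0) jet k))
        hasDerivative-S k zero    _   = hasDerivative-const 0# a
        hasDerivative-S k (suc n) n<K = hasDerivative-⊕ (hasDerivative-S k n (ℕ.<⇒≤ n<K))
          (hasDerivative-≈
            (trans (+-congˡ (zeroˡ _)) (trans (+-identityʳ _) (*-congˡ (+-cong
              (*-congʳ (1/z^-irrelevant m a (proj₁ d₁) a≠0))
              (*-congˡ (jet-val (ℕ.<⇒≤ n<K) (proj₁ d₂)))))))
            (hasDerivative-⊗ (hasDerivative-const (γ k n) a) (hasDerivative-⊗ d₁ d₂)))
          where
          m : ℕ
          m = 2 ℕ.* k ∸ n
          d₁ : HasDerivative (1/z^ m) a (- (fromℤ (+ m) * inverse a a≠0 ^ suc m))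
          d₁ = hasDerivative-1/z^ a≠0 m
          d₂ : HasDerivative ((D ^∘ n) f) a (jet (suc n))
          d₂ = hasDerivative-D^ n<K

    -- The leading coefficient is 1, so the top derivative can be solved for.
    D^-from-S : ∀ k {a w} → HasDerivative (S (suc k) (2 ℕ.+ k)) a w → Dom ((D ^∘ (2 ℕ.+ k)) f) a
    D^-from-S k {a} d = _ , hasDerivative-local (everywhere solved) refl
      (hasDerivative-⊗ (hasDerivative-^ᶠ (λ _ _ _ → refl) (hasDerivative-identity a) m)
        (hasDerivative-⊕ d (hasDerivative-⊗ (hasDerivative-const (- 1#) a)
          (hasDerivative-S a≠0 (suc k) D^-defined (suc k) (suc k) ℕ.≤-refl))))
      where
      m : ℕ
      m = 2 ℕ.* suc k ∸ suc k

      top : PartialFn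
      top = (identity ^ᶠ m) ⊗ (S (suc k) (2 ℕ.+ k) ⊕ (const (- 1#) ⊗ S (suc k) (suc k)))

      a≠0 : NonZero a
      a≠0 = let _ , _ , a≠0 , _ = proj₁ d in a≠0

      -- Differentiability of the sum at `a` includes `a` lying in its domain, which gives all
      -- derivatives through order `suc k`. That is enough to differentiate the terms of order at
      -- most `k`.
      D^-defined : ∀ s → s ≤ suc k → Dom ((D ^∘ s) f) a
      D^-defined s s≤k = S-D^ (proj₁ d) s (s≤s s≤k)

      solved : ∀ z → Dom top z →
        Dom ((D ^∘ suc k) f) z × (∀ p q → val top z p ≈ val ((D ^∘ suc k) f) z q)
      solved z (_ , (_ , _ , _ , q₀) , _) = q₀ , λ (_ , (p , _ , z≠0 , q) , _ , p′) q′ → let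
          Σ  = val (S (suc k) (suc k)) z p
          Σ′ = val (S (suc k) (suc k)) z p′
          y  = val ((D ^∘ suc k) f) z q
          x  = inverse z z≠0
        in begin
          z ^ m * ((Σ + γ (suc k) (suc k) * (x ^ m * y)) + - 1# * Σ′)
            ≈⟨ *-congˡ (+-cong (+-congˡ (*-congʳ (γ-diagonal k)))
                 (*-congˡ (S-irrelevant (suc k) (suc k) z p′ p))) ⟩
          z ^ m * ((Σ + 1# * (x ^ m * y)) + - 1# * Σ)
            ≈⟨ solve 4 (λ Σ y X Z → Z :* ((Σ :+ con ℤ.1ℤ :* (X :* y)) :+ :- con ℤ.1ℤ :* Σ) :=
                 Z :* X :* y) refl Σ y (x ^ m) (z ^ m) ⟩
          z ^ m * x ^ m * y
            ≈⟨ *-congʳ (x^m*y^m≈1 m (trans (*-comm _ _) (inverseˡ z z≠0))) ⟩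
          1# * y
            ≈⟨ *-identityˡ y ⟩
          y ≈⟨ D^-irrelevant (suc k) z q q′ ⟩
          val ((D ^∘ suc k) f) z q′ ∎

    -- Both domains amount to `a` being nonzero and all derivatives through order `2 + k` existing
    -- at `a`. From the left, the top one comes from `D^-from-S`, the lower ones from the domain of
    -- the sum.
    A₃-S : ∀ k → A₃ (S (suc k) (2 ℕ.+ k)) ≃ S (2 ℕ.+ k) (3 ℕ.+ k)
    A₃-S k = record
      { Dom-⇔ = λ a → mk⇔
          (λ (a≠0 , w , d) → S-Dom a≠0 (2 ℕ.+ k) (defined d) (2 ℕ.+ k) (3 ℕ.+ k) ℕ.≤-refl)
          (λ q → nonZero q , _ , derivative q)
      ; val-≈ = λ a (a≠0 , w , d) q → begin
          inverse a a≠0 * 1# * w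
            ≈⟨ *-cong (trans (*-identityʳ _) (inverse-cong a≠0 (nonZero q) refl))
                 (derivative-unique (S-irrelevant (suc k) (2 ℕ.+ k)) d (derivative q)) ⟩
          inverse a (nonZero q) * Σ< (2 ℕ.+ k) (summand′ (inverse a (nonZero q)) (jetOf q) (suc k))
            ≈⟨ Σ-summand-suc (inverse a (nonZero q)) (jetOf q) k ⟩
          Σ< (3 ℕ.+ k) (summand (inverse a (nonZero q)) (jetOf q) (2 ℕ.+ k))
            ≈⟨ S-val (nonZero q) (2 ℕ.+ k) (definedʳ q) (2 ℕ.+ k) (3 ℕ.+ k) ℕ.≤-refl q ⟨
          val (S (2 ℕ.+ k) (3 ℕ.+ k)) a q ∎
      }
      where
      nonZero : ∀ {a} → Dom (S (2 ℕ.+ k) (3 ℕ.+ k)) a → NonZero a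
      nonZero (_ , _ , a≠0 , _) = a≠0

      definedʳ : ∀ {a} → Dom (S (2 ℕ.+ k) (3 ℕ.+ k)) a → ∀ s → s ≤ 2 ℕ.+ k → Dom ((D ^∘ s) f) a
      definedʳ q s s≤ = S-D^ q s (s≤s s≤)

      jetOf : ∀ {a} → Dom (S (2 ℕ.+ k) (3 ℕ.+ k)) a → ℕ → ℂ
      jetOf q = jet (nonZero q) (2 ℕ.+ k) (definedʳ q)

      derivative : ∀ {a} (q : Dom (S (2 ℕ.+ k) (3 ℕ.+ k)) a) → HasDerivative (S (suc k) (2 ℕ.+ k)) a _
      derivative q = hasDerivative-S (nonZero q) (2 ℕ.+ k) (definedʳ q) (suc k) (2 ℕ.+ k) ℕ.≤-refl

      defined : ∀ {a w} → HasDerivative (S (suc k) (2 ℕ.+ k)) a w → ∀ s → s ≤ 2 ℕ.+ k → Dom ((D ^∘ s) f) a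
      defined d s s≤ with s ℕ.≟ 2 ℕ.+ k
      ... | yes ≡.refl = D^-from-S k d
      ... | no  s≢     = S-D^ (proj₁ d) s (ℕ.≤∧≢⇒< s≤ s≢)

    A₃≃S : A₃ f ≃ S 1 2
    A₃≃S = record
      { Dom-⇔ = λ a → mk⇔
          -- The term `s = 0` has coefficient zero but still asks for `f` to be defined at `a`; the
          -- proof of differentiability contains this.
          (λ (a≠0 , w , d) → (tt , tt , a≠0 , proj₁ d) , tt , a≠0 , w , d)
          (λ (_ , _ , a≠0 , d) → a≠0 , d)
      ; val-≈ = λ a (a≠0 , w) ((_ , _ , a≠0′ , y) , _ , a≠0″ , w′) → begin
          inverse a a≠0 ^ 1 * proj₁ w
            ≈⟨ *-cong (1/z^-irrelevant 1 a a≠0 a≠0″) (D^-irrelevant 1 a w w′) ⟩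
          inverse a a≠0″ ^ 1 * proj₁ w′
            ≈⟨ solve 2 (λ u v → v := (con ℤ.0ℤ :+ con ℤ.0ℤ :* u) :+ con ℤ.1ℤ :* v) refl
                 (inverse a a≠0′ ^ 2 * val f a y) (inverse a a≠0″ ^ 1 * proj₁ w′) ⟩
          (0# + 0# * (inverse a a≠0′ ^ 2 * val f a y)) + 1# * (inverse a a≠0″ ^ 1 * proj₁ w′)
            ≈⟨ +-cong (+-congˡ (*-congʳ (γ-zero 1))) (*-congʳ (γ-diagonal 0)) ⟨
          (0# + γ 1 0 * (inverse a a≠0′ ^ 2 * val f a y)) + γ 1 1 * (inverse a a≠0″ ^ 1 * proj₁ w′) ∎
      }

    A₃-cong : ∀ {g h} → g ≃ h → A₃ g ≃ A₃ h
    A₃-cong e = ⊗-cong (≃-refl {1/z^ 1} (1/z^-irrelevant 1)) (D-cong e)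

    A₃^≃S : ∀ k → (A₃ ^∘ suc k) f ≃ S (suc k) (2 ℕ.+ k)
    A₃^≃S zero    = A₃≃S
    A₃^≃S (suc k) = ≃-trans (A₃-cong (A₃^≃S k)) (A₃-S k)

open import Data.Nat.Base using (_≤_; _*_; _∸_)

theorem5p2 : (R : Reals) → let open Operators R hiding (_*_) in
    (k : ℕ) → 1 ≤ k →
    A₃ ^∘ k ≈ₒ ∑[0⋯ k ] (λ s →
    multiplyBy (const (fromℤ (coefficient k s))) ∘
    multiplyBy (1/z^ (2 * k ∸ s)) ∘
    (D ^∘ s))
theorem5p2 R (suc k) _ f meromorphic = ≃-trans (A₃^≃S f f-irrelevant k)
  (≃-sym (∑≃partialSum (2 ℕ.+ k) (termₒ (suc k)) (term-irrelevant f f-irrelevant (suc k))))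
  where
  open PowersOfA₃ R
  f-irrelevant : ProofIrrelevant f
  f-irrelevant z p q = Extensional.val-cong (Meromorphic.extensional meromorphic) p q refl
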